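{- Suppose that $k \ge r_1 \ge r_2 > i \ge 1$ are integers. Then \[ \left( \frac{\Phi_{k,r_1,i}}{\binom{k-i}{r_1-i}} \right)^{1/(r_1-i)} \le \left( \frac{\Phi_{k,r_2,i}}{\binom{k-i}{r_2-i}} \right)^{1/(r_2-i)}. \]
   Context: An $r$-graph $\mathcal{H}$ is a collection of $r$-element subsets (edges) of a finite vertex set $V(\mathcal{H})$; a vertex is isolated if it lies in no edge. For $1\le i<r$, let $\partial_{r-i}\mathcal{H}$ denote the set of $i$-subsets of $V(\mathcal{H})$ contained in some edge. For an $i$-set $S$, $d_{\mathcal{H}}(S)$ is the number of $(r-i)$-sets $T$ with $S\cup T\in\mathcal{H}$ (and $S\cap T=\emptyset$). The positive minimum $i$-degree is $\delta^{+}_{i}(\mathcal{H}) = \min\{d_{\mathcal{H}}(S) : S\in\partial_{r-i}\mathcal{H}\}$. A $k$-coloring of $\mathcal{H}$ is a map $V(\mathcal{H})\to[k]$ injective on every edge; $\mathcal{H}$ is $k$-partite if it has one. Two $k$-colorings $\varphi,\vartheta$ are equivalent if $\vartheta=\eta\circ\varphi$ for a permutation $\eta$ of $[k]$; $\mathcal{H}$ is uniquely $k$-colorable if it is $k$-colorable and any two $k$-colorings are equivalent. For integers $k\ge r>i\ge1$, $\Phi_{k,r,i}$ is the minimum real number such that for every $n\ge k$, every $n$-vertex $k$-partite $r$-graph $\mathcal{H}$ without isolated vertices and with $\delta^{+}_{i}(\mathcal{H}) > \Phi_{k,r,i}\, n^{r-i}$ is uniquely $k$-colorable. -}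

module Defs where

open import Data.Nat using (ℕ; zero; suc; _∸_; _≤_; _^_; _≡ᵇ_)
open import Data.Nat.Combinatorics using (_C_)
open import Data.Bool using (Bool; true; false; _∧_)
open import Data.Fin using (Fin)
open import Data.Fin.Subset using (Subset; _∈_; _⊆_; _∪_; ∣_∣)
open import Data.Fin.Permutation using (Permutation′; _⟨$⟩ʳ_)
open import Data.Vec using ([]; _∷_)
open import Data.List using (List; []; _∷_; map; _++_; filter; length)
open import Data.Product using (Σ; _×_; ∃)
open import Data.Integer using (+_)
open import Data.Rational using (ℚ; _/_; _*_; _<_; 1ℚ)
open import Relation.Binary.PropositionalEquality using (_≡_)
open import Relation.Nullary.Decidable using (Dec; _because_)
open import Relation.Nullary.Reflects using (Reflects)
open import Relation.Unary using (Decidable)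

ℕ→ℚ : ℕ → ℚ
ℕ→ℚ n = + n / 1

_^ℚ_ : ℚ → ℕ → ℚ
q ^ℚ zero    = 1ℚ
q ^ℚ (suc m) = q * (q ^ℚ m)

allSubsets : (n : ℕ) → List (Subset n)
allSubsets zero    = [] ∷ []
allSubsets (suc n) = map (false ∷_) (allSubsets n) ++ map (true ∷_) (allSubsets n)

disjointᵇ : {n : ℕ} → Subset n → Subset n → Bool
disjointᵇ []          []          = true
disjointᵇ (true ∷ s)  (true ∷ t)  = false
disjointᵇ (false ∷ s) (_ ∷ t)     = disjointᵇ s t
disjointᵇ (true ∷ s)  (false ∷ t) = disjointᵇ s t

Hypergraph : ℕ → Set
Hypergraph n = Subset n → Bool

module _ {n : ℕ} (H : Hypergraph n) where

  Edge : Subset n → Set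
  Edge e = H e ≡ true

  IsRGraph : ℕ → Set
  IsRGraph r = ∀ e → Edge e → ∣ e ∣ ≡ r

  NoIsolated : Set
  NoIsolated = ∀ (v : Fin n) → ∃ λ e → Edge e × v ∈ e

  InShadow : ℕ → Subset n → Set
  InShadow i S = ∣ S ∣ ≡ i × ∃ λ e → Edge e × S ⊆ e

  deg : ℕ → Subset n → ℕ
  deg r S = length (filter test (allSubsets n))
    where
      testᵇ : Subset n → Bool
      testᵇ T = (∣ T ∣ ≡ᵇ (r ∸ ∣ S ∣)) ∧ disjointᵇ S T ∧ H (S ∪ T)
      test : Decidable (λ T → testᵇ T ≡ true)
      test T with testᵇ T
      ... | true  = true because Reflects.ofʸ _≡_.refl
      ... | false = false because Reflects.ofⁿ (λ ())

  MinPosDegGt : ℕ → ℕ → ℚ → Set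
  MinPosDegGt r i c = ∀ S → InShadow i S → c * ℕ→ℚ (n ^ (r ∸ i)) < ℕ→ℚ (deg r S)

  IsColoring : (k : ℕ) → (Fin n → Fin k) → Set
  IsColoring k φ = ∀ e → Edge e → ∀ u v → u ∈ e → v ∈ e → φ u ≡ φ v → u ≡ v

  Partite : ℕ → Set
  Partite k = Σ (Fin n → Fin k) (IsColoring k)

  UniquelyColorable : ℕ → Set
  UniquelyColorable k =
    Partite k ×
    (∀ φ ϑ → IsColoring k φ → IsColoring k ϑ →
       Σ (Permutation′ k) λ η → ∀ v → ϑ v ≡ η ⟨$⟩ʳ φ v)

-- Good k r i c : the threshold c works in the definition of Φ_{k,r,i},
-- i.e. every n-vertex (n ≥ k) k-partite r-graph without isolated vertices
-- and with δ⁺_i > c n^{r-i} is uniquely k-colorable.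
-- Φ_{k,r,i} is the minimum c with Good k r i c; the set of such c is
-- upward closed, so for real x:  Φ ≤ x  ⇔  Good k r i x.
Good : ℕ → ℕ → ℕ → ℚ → Set
Good k r i c =
  ∀ (n : ℕ) → k ≤ n → (H : Hypergraph n) →
  IsRGraph H r → Partite H k → NoIsolated H → MinPosDegGt H r i c →
  UniquelyColorable H k

ΦLt : ℕ → ℕ → ℕ → ℚ → Set
ΦLt k r i x = ∃ λ c → c < x × Good k r i c

ΦLe : ℕ → ℕ → ℕ → ℚ → Set
ΦLe k r i x = Good k r i x

{-# OPTIONS --safe #-}
module Submission where

-- Pass from H to the r₂-graph H′ of all r₂-sets contained in an edge: every colouring of H is a colouring
-- of H′, so it suffices that H′ has large positive i-degree. The link of an i-set S in H is an m-partite
-- a-graph L with m = k - i and a = r₁ - i (the colours of S are unavailable), and the link in H′ contains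
-- its shadow, so everything reduces to the Kruskal–Katona inequality for m-partite hypergraphs:
-- |L| > C(m,a) t^a implies |∂L| > C(m,a-1) t^(a-1), applied a few times.
--
-- That inequality is proved by induction on a through vertex links. Let K = ∂L and f = |K|, and for a colour c
-- let D_c and E_c = f - D_c count the edges of K meeting and avoiding c. If v has colour c, its link in L
-- has at most E_c edges, and its shadow lies in the link of v in K; the induction hypothesis therefore
-- bounds deg_L(v) / deg_K(v) by a multiple of E_c^(1/(a-1)). Summing over v bounds |L| by a multiple
-- of the sum of D_c E_c^(1/(a-1)), a concave function of D_c, and the D_c have mean (a-1) f / m.
-- Replacing the root by its tangent line keeps everything rational and turns Jensen into Cauchy–Schwarz.

open import Defs
open import Algebra.Bundles using (CommutativeMonoid)
import Algebra.Properties.CommutativeSemigroup as CommutativeSemigroupProperties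
open import Data.Bool using (Bool; true; false; _∧_; not; T)
import Data.Bool.Properties as Bool
open import Data.Empty using (⊥)
open import Data.Fin using (Fin; zero; suc)
open import Data.Fin.Properties as Fin using (_≟_)
open import Data.Fin.Subset using (Subset; ∣_∣; _∈_; _⊆_; _∪_)
open import Data.Fin.Subset.Properties using (anySubset?; _⊆?_; ⊆-refl; p⊆p∪q; q⊆p∪q; x∈p∪q⁻; s⊆s; out⊆)
open import Data.Integer as ℤ using (-[1+_])
import Data.Integer.Properties as ℤ
open import Data.List as List using (List; []; _∷_; _++_; length; allFin; filter)
open import Data.List.Properties using (map-tabulate; length-tabulate)
open import Data.Nat using (ℕ; zero; suc; _+_; _*_; _∸_; _^_; _!; _≤_; _<_; _≤?_; _≡ᵇ_; z≤n; s≤s; NonZero)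
open import Data.Nat.Combinatorics using (_C_; nCk≡n!/k![n-k]!; k![n∸k]!∣n!; nC1≡n)
open import Data.Nat.DivMod using (m/n*n≡m)
open import Data.Nat.Properties hiding (_≟_)
open import Data.Nat.Tactic.RingSolver using (solve-∀)
open import Data.Product using (_,_; _×_; ∃; ∃₂; proj₁; proj₂)
open import Data.Rational as ℚ using (ℚ; mkℚ; 0ℚ; *≤*; Positive; toℚᵘ)
import Data.Rational.Properties as ℚ
open import Data.Rational.Unnormalised as ℚᵘ using (mkℚᵘ; *<*; *≡*; _≃_)
import Data.Rational.Unnormalised.Properties as ℚᵘ
open import Data.Sum using (inj₁; inj₂)
open import Data.Vec using ([]; _∷_; lookup; _[_]≔_; here; there)
open import Data.Vec.Properties using ([]=⇒lookup; lookup⇒[]=; []≔-idempotent; []≔-lookup; []≔-commutes; lookup∘updateAt; lookup∘updateAt′)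
open import Function using (_∘_; id)
open import Relation.Binary.PropositionalEquality
open import Relation.Nullary using (Dec; does; yes; no; contradiction; _×-dec_)
open import Relation.Nullary.Decidable using (dec-true)
open import Relation.Unary using (Decidable)
open CommutativeSemigroupProperties (CommutativeMonoid.commutativeSemigroup ℚ.*-1-commutativeMonoid) using (interchange; xy∙z≈xz∙y)

private variable
  I I′ : Set
  n k : ℕ

-- Arithmetic

choose-factorials : ∀ k l → ((k + l) C k) * (k ! * l !) ≡ (k + l) !
choose-factorials k l = begin
  ((k + l) C k) * (k ! * l !)
    ≡⟨ cong (λ x → ((k + l) C k) * (k ! * x !)) (m+n∸m≡n k l) ⟨
  ((k + l) C k) * (k ! * (k + l ∸ k) !)
    ≡⟨ cong (_* (k ! * (k + l ∸ k) !)) (nCk≡n!/k![n-k]! (m≤m+n k l)) ⟩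
  _ ≡⟨ m/n*n≡m (k![n∸k]!∣n! (m≤m+n k l)) ⟩
  (k + l) ! ∎
  where
    open ≡-Reasoning
    instance _ = k !* (k + l ∸ k) !≢0

-- Both sides times `b ! * p !` give `(suc b + p) !`. With m = suc b + p this is the ratio of C(m, b
-- + 1) to C(m, b).
choose-suc : ∀ b p → ((suc b + p) C suc b) * suc b ≡ ((suc b + p) C b) * suc p
choose-suc b p = *-cancelʳ-≡ _ _ (b ! * p !) (begin
  x * suc b * (b ! * p !)        ≡⟨ lhs x (suc b) (b !) (p !) ⟩
  x * (suc b ! * p !)            ≡⟨ choose-factorials (suc b) p ⟩
  (suc b + p) !                  ≡⟨ cong _! (+-suc b p) ⟨
  (b + suc p) !                  ≡⟨ choose-factorials b (suc p) ⟨
  ((b + suc p) C b) * (b ! * suc p !) ≡⟨ cong (λ n → (n C b) * (b ! * suc p !)) (+-suc b p) ⟩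
  y * (b ! * suc p !)            ≡⟨ rhs y (suc p) (b !) (p !) ⟩
  y * suc p * (b ! * p !)        ∎)
  where
    open ≡-Reasoning
    instance _ = b !* p !≢0
    x = (suc b + p) C suc b
    y = (suc b + p) C b
    lhs : ∀ x s b p → x * s * (b * p) ≡ x * ((s * b) * p)
    lhs = solve-∀
    rhs : ∀ x s b p → x * (b * (s * p)) ≡ x * s * (b * p)
    rhs = solve-∀

-- Compares m - 1 with m colours at the same uniformity, as is needed once a vertex link has used up
-- a colour.
choose-pred : ∀ b p → ((b + p) C b) * (suc b + p) ≡ ((suc b + p) C b) * suc p
choose-pred b p = *-cancelʳ-≡ _ _ (b ! * p !) (begin
  x * (suc b + p) * (b ! * p !)  ≡⟨ lhs x (suc b + p) (b ! * p !) ⟩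
  (suc b + p) * (x * (b ! * p !)) ≡⟨ cong ((suc b + p) *_) (choose-factorials b p) ⟩
  (suc b + p) !                  ≡⟨ cong _! (+-suc b p) ⟨
  (b + suc p) !                  ≡⟨ choose-factorials b (suc p) ⟨
  ((b + suc p) C b) * (b ! * suc p !) ≡⟨ cong (λ n → (n C b) * (b ! * suc p !)) (+-suc b p) ⟩
  y * (b ! * suc p !)            ≡⟨ rhs y (suc p) (b !) (p !) ⟩
  y * suc p * (b ! * p !)        ∎)
  where
    open ≡-Reasoning
    instance _ = b !* p !≢0
    x = (b + p) C b
    y = (suc b + p) C b
    lhs : ∀ x s t → x * s * t ≡ s * (x * t)
    lhs = solve-∀
    rhs : ∀ x s b p → x * (b * (s * p)) ≡ x * s * (b * p)
    rhs = solve-∀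

2mn≤m²+n² : ∀ m n → 2 * (m * n) ≤ m * m + n * n
2mn≤m²+n² m n with ≤-total m n
... | inj₁ m≤n = subst (λ k → 2 * (m * k) ≤ m * m + k * k) (m+[n∸m]≡n m≤n)
                   (≤-trans (m≤m+n _ (d * d)) (≤-reflexive (eq m d)))
  where
    d = n ∸ m
    eq : ∀ m d → 2 * (m * (m + d)) + d * d ≡ m * m + (m + d) * (m + d)
    eq = solve-∀
... | inj₂ n≤m = subst (λ k → 2 * (k * n) ≤ k * k + n * n) (m+[n∸m]≡n n≤m)
                   (≤-trans (m≤m+n _ (d * d)) (≤-reflexive (eq n d)))
  where
    d = m ∸ n
    eq : ∀ n d → 2 * ((n + d) * n) + d * d ≡ (n + d) * (n + d) + n * n
    eq = solve-∀

-- Bernoulli's inequality (z/w)^(1+β) ≥ 1 + (1+β)(z/w − 1), cleared of denominators and subtraction.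
bernoulli : ∀ β z w → suc β * (z * w ^ β) ≤ z ^ suc β + β * w ^ suc β
bernoulli zero    z w = ≤-reflexive (eq z)
  where
    eq : ∀ z → 1 * (z * 1) ≡ z * 1 + 0
    eq = solve-∀
-- Adding `β * (w * W) * z` completes the left side to a multiple of `2 * (z * w)`; on the right it
-- is z times the last term of the induction hypothesis.
bernoulli (suc β) z w = +-cancelʳ-≤ (β * (w * W) * z) _ _ (begin
  suc (suc β) * (z * (w * W)) + β * (w * W) * z ≡⟨ eq₁ β z w W ⟩
  suc β * W * (2 * (z * w))             ≤⟨ *-monoʳ-≤ (suc β * W) (2mn≤m²+n² z w) ⟩
  suc β * W * (z * z + w * w)           ≡⟨ eq₂ β z w W ⟩
  z * (suc β * (z * W)) + suc β * (w * (w * W)) ≤⟨ +-monoˡ-≤ _ (*-monoʳ-≤ z (bernoulli β z w)) ⟩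
  z * (z ^ suc β + β * (w * W)) + suc β * (w * (w * W)) ≡⟨ eq₃ β z w W (z ^ suc β) ⟩
  z * z ^ suc β + suc β * (w * (w * W)) + β * (w * W) * z ∎)
  where
    open ≤-Reasoning
    W = w ^ β
    eq₁ : ∀ β z w W → suc (suc β) * (z * (w * W)) + β * (w * W) * z ≡ suc β * W * (2 * (z * w))
    eq₁ = solve-∀
    eq₂ : ∀ β z w W → suc β * W * (z * z + w * w) ≡ z * (suc β * (z * W)) + suc β * (w * (w * W))
    eq₂ = solve-∀
    eq₃ : ∀ β z w W Z → z * (Z + β * (w * W)) + suc β * (w * (w * W)) ≡ z * Z + suc β * (w * (w * W)) + β * (w * W) * z
    eq₃ = solve-∀

^-distribʳ-* : ∀ n x y → (x * y) ^ n ≡ x ^ n * y ^ n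
^-distribʳ-* zero    x y = refl
^-distribʳ-* (suc n) x y = trans (cong (x * y *_) (^-distribʳ-* n x y)) (eq x y (x ^ n) (y ^ n))
  where
    eq : ∀ x y u v → x * y * (u * v) ≡ x * u * (y * v)
    eq = solve-∀

-- Weighted AM-GM for β copies of x and one y. It is `bernoulli` at z = β x + y and w = (1 + β) x,
-- with the term `β * w ^ suc β` cancelled.
am-gm : ∀ β x y → suc β ^ suc β * (x ^ β * y) ≤ (β * x + y) ^ suc β
am-gm β x y = +-cancelʳ-≤ (β * w ^ suc β) _ _ (begin
  suc β * suc β ^ β * (x ^ β * y) + β * (w * w ^ β)
    ≡⟨ cong (λ u → suc β * suc β ^ β * (x ^ β * y) + β * (w * u)) (^-distribʳ-* β (suc β) x) ⟩
  suc β * suc β ^ β * (x ^ β * y) + β * (w * (suc β ^ β * x ^ β))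
    ≡⟨ eq β x y (suc β ^ β) (x ^ β) ⟩
  suc β * ((β * x + y) * (suc β ^ β * x ^ β))
    ≡⟨ cong (λ u → suc β * ((β * x + y) * u)) (^-distribʳ-* β (suc β) x) ⟨
  suc β * ((β * x + y) * w ^ β)
    ≤⟨ bernoulli β (β * x + y) w ⟩
  (β * x + y) ^ suc β + β * w ^ suc β ∎)
  where
    open ≤-Reasoning
    w = suc β * x
    eq : ∀ β x y s X → suc β * s * (X * y) + β * (suc β * x * (s * X)) ≡ suc β * ((β * x + y) * (s * X))
    eq = solve-∀

-- Finite sums

∑ : List I → (I → ℕ) → ℕ
∑ []       f = 0
∑ (x ∷ xs) f = f x + ∑ xs f

∑-cong : ∀ (xs : List I) {f g : I → ℕ} → (∀ x → f x ≡ g x) → ∑ xs f ≡ ∑ xs g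
∑-cong []       f≗g = refl
∑-cong (x ∷ xs) f≗g = cong₂ _+_ (f≗g x) (∑-cong xs f≗g)

∑-mono : ∀ (xs : List I) {f g : I → ℕ} → (∀ x → f x ≤ g x) → ∑ xs f ≤ ∑ xs g
∑-mono []       f≤g = z≤n
∑-mono (x ∷ xs) f≤g = +-mono-≤ (f≤g x) (∑-mono xs f≤g)

∑-+ : ∀ (xs : List I) (f g : I → ℕ) → ∑ xs (λ x → f x + g x) ≡ ∑ xs f + ∑ xs g
∑-+ []       f g = refl
∑-+ (x ∷ xs) f g = trans (cong (f x + g x +_) (∑-+ xs f g)) (eq (f x) (g x) (∑ xs f) (∑ xs g))
  where
    eq : ∀ a b c d → a + b + (c + d) ≡ a + c + (b + d)
    eq = solve-∀

∑-*ˡ : ∀ (xs : List I) c (f : I → ℕ) → ∑ xs (λ x → c * f x) ≡ c * ∑ xs f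
∑-*ˡ []       c f = sym (*-zeroʳ c)
∑-*ˡ (x ∷ xs) c f = trans (cong (c * f x +_) (∑-*ˡ xs c f)) (sym (*-distribˡ-+ c (f x) (∑ xs f)))

∑-*ʳ : ∀ (xs : List I) c (f : I → ℕ) → ∑ xs (λ x → f x * c) ≡ ∑ xs f * c
∑-*ʳ xs c f = trans (∑-cong xs (λ x → *-comm (f x) c)) (trans (∑-*ˡ xs c f) (*-comm c (∑ xs f)))

∑-0 : ∀ (xs : List I) → ∑ xs (λ _ → 0) ≡ 0
∑-0 []       = refl
∑-0 (x ∷ xs) = ∑-0 xs

∑-1 : ∀ (xs : List I) → ∑ xs (λ _ → 1) ≡ length xs
∑-1 []       = refl
∑-1 (x ∷ xs) = cong suc (∑-1 xs)

∑-swap : ∀ (xs : List I) (ys : List I′) (f : I → I′ → ℕ) →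
         ∑ xs (λ x → ∑ ys (f x)) ≡ ∑ ys (λ y → ∑ xs (λ x → f x y))
∑-swap []       ys f = sym (∑-0 ys)
∑-swap (x ∷ xs) ys f = trans (cong (∑ ys (f x) +_) (∑-swap xs ys f))
                             (sym (∑-+ ys (f x) (λ y → ∑ xs (λ x → f x y))))

∑-++ : ∀ (xs ys : List I) (f : I → ℕ) → ∑ (xs ++ ys) f ≡ ∑ xs f + ∑ ys f
∑-++ []       ys f = refl
∑-++ (x ∷ xs) ys f = trans (cong (f x +_) (∑-++ xs ys f)) (sym (+-assoc (f x) _ _))

∑-map : ∀ (g : I′ → I) (xs : List I′) (f : I → ℕ) → ∑ (List.map g xs) f ≡ ∑ xs (f ∘ g)
∑-map g []       f = refl
∑-map g (x ∷ xs) f = cong (f (g x) +_) (∑-map g xs f)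

∑-allFin-suc : (f : Fin (suc n) → ℕ) → ∑ (allFin (suc n)) f ≡ f zero + ∑ (allFin n) (f ∘ suc)
∑-allFin-suc {n} f = cong (f zero +_)
  (trans (cong (λ xs → ∑ xs f) (sym (map-tabulate id suc))) (∑-map suc (allFin n) f))

∑-allSubsets-suc : (f : Subset (suc n) → ℕ) →
  ∑ (allSubsets (suc n)) f ≡ ∑ (allSubsets n) (f ∘ (false ∷_)) + ∑ (allSubsets n) (f ∘ (true ∷_))
∑-allSubsets-suc {n} f = trans (∑-++ (List.map (false ∷_) s) (List.map (true ∷_) s) f)
                               (cong₂ _+_ (∑-map _ s f) (∑-map _ s f))
  where s = allSubsets n

𝟙 : Bool → ℕ
𝟙 true  = 1
𝟙 false = 0

-- The decision procedure is arbitrary because the one that `deg` filters by is local to its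
-- definition.
length-filter-∑ : ∀ (b : I → Bool) (P? : Decidable (λ x → b x ≡ true)) xs →
                  length (filter P? xs) ≡ ∑ xs (𝟙 ∘ b)
length-filter-∑ b P? []       = refl
length-filter-∑ b P? (x ∷ xs) with P? x | b x in eq
... | yes _  | true  = cong suc (length-filter-∑ b P? xs)
... | yes p  | false = contradiction (trans (sym p) eq) λ ()
... | no ¬p  | true  = contradiction eq ¬p
... | no _   | false = length-filter-∑ b P? xs

δ : Fin k → Fin k → ℕ
δ x c = 𝟙 (does (x ≟ c))

δ-refl : (x : Fin k) → δ x x ≡ 1
δ-refl x with x ≟ x
... | yes _  = refl
... | no x≢x = contradiction refl x≢x

∑-δ : (x : Fin k) (g : Fin k → ℕ) → ∑ (allFin k) (λ c → δ x c * g c) ≡ g x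
∑-δ {suc k} zero g = trans (∑-allFin-suc (λ c → δ zero c * g c))
  (trans (cong (1 * g zero +_) (∑-0 (allFin k))) (eq (g zero)))
  where
    eq : ∀ a → 1 * a + 0 ≡ a
    eq = solve-∀
∑-δ {suc k} (suc x) g = trans (∑-allFin-suc (λ c → δ (suc x) c * g c))
  (trans (∑-cong (allFin k) (λ c → refl)) (∑-δ x (g ∘ suc)))

∑-lookup : (e : Subset n) → ∑ (allFin n) (𝟙 ∘ lookup e) ≡ ∣ e ∣
∑-lookup []          = refl
∑-lookup (true ∷ e)  = trans (∑-allFin-suc (𝟙 ∘ lookup (true ∷ e))) (cong suc (∑-lookup e))
∑-lookup (false ∷ e) = trans (∑-allFin-suc (𝟙 ∘ lookup (false ∷ e))) (∑-lookup e)

∑-allFin-1 : ∀ k → ∑ (allFin k) (λ _ → 1) ≡ k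
∑-allFin-1 k = trans (∑-1 (allFin k)) (length-tabulate id)

-- Links and shadows

size : Hypergraph n → ℕ
size {n} L = ∑ (allSubsets n) (𝟙 ∘ L)

link : Fin n → Hypergraph n → Hypergraph n
link v L e = not (lookup e v) ∧ L (e [ v ]≔ true)

-- Erasing v maps the edges through v bijectively onto the link. In the recursion this exchanges the
-- two halves of `allSubsets` at the coordinate v.
size-link : (v : Fin n) (L : Hypergraph n) →
            size (link v L) ≡ ∑ (allSubsets n) (λ e → 𝟙 (lookup e v) * 𝟙 (L e))
size-link {suc n} zero L = begin
  size (link zero L)  ≡⟨ ∑-allSubsets-suc (𝟙 ∘ link zero L) ⟩
  ∑ s (𝟙 ∘ L ∘ (true ∷_)) + ∑ s (λ _ → 0) ≡⟨ +-comm (∑ s (𝟙 ∘ L ∘ (true ∷_))) _ ⟩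
  ∑ s (λ _ → 0) + ∑ s (𝟙 ∘ L ∘ (true ∷_)) ≡⟨ cong (∑ s (λ _ → 0) +_) (∑-cong s (λ e → +-identityʳ _)) ⟨
  ∑ s (λ _ → 0) + ∑ s (λ e → 1 * 𝟙 (L (true ∷ e))) ≡⟨ ∑-allSubsets-suc (λ e → 𝟙 (lookup e zero) * 𝟙 (L e)) ⟨
  _ ∎
  where
    open ≡-Reasoning
    s = allSubsets n
size-link {suc n} (suc v) L = trans (∑-allSubsets-suc (𝟙 ∘ link (suc v) L))
  (trans (cong₂ _+_ (size-link v (L ∘ (false ∷_))) (size-link v (L ∘ (true ∷_))))
         (sym (∑-allSubsets-suc (λ e → 𝟙 (lookup e (suc v)) * 𝟙 (L e)))))

𝟙*-cong : ∀ b {x y} → (b ≡ true → x ≡ y) → 𝟙 b * x ≡ 𝟙 b * y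
𝟙*-cong true  eq = cong (1 *_) (eq refl)
𝟙*-cong false eq = refl

𝟙*-mono : ∀ b {x y} → (b ≡ true → x ≤ y) → 𝟙 b * x ≤ 𝟙 b * y
𝟙*-mono true  le = *-monoʳ-≤ 1 (le refl)
𝟙*-mono false le = z≤n

𝟙-mono : ∀ b c → (b ≡ true → c ≡ true) → 𝟙 b ≤ 𝟙 c
𝟙-mono false c     imp = z≤n
𝟙-mono true  true  imp = ≤-refl
𝟙-mono true  false imp with imp refl
... | ()

size-mono : (L K : Hypergraph n) → (∀ e → Edge L e → Edge K e) → size L ≤ size K
size-mono {n} L K imp = ∑-mono (allSubsets n) (λ e → 𝟙-mono (L e) (K e) (imp e))

-- Double counting of the incidences between vertices and edges.
handshake : ∀ {a} (L : Hypergraph n) → IsRGraph L a → ∑ (allFin n) (λ v → size (link v L)) ≡ a * size L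
handshake {n} {a} L uni = begin
  ∑ (allFin n) (λ v → size (link v L)) ≡⟨ ∑-cong (allFin n) (λ v → size-link v L) ⟩
  ∑ (allFin n) (λ v → ∑ s (λ e → 𝟙 (lookup e v) * 𝟙 (L e))) ≡⟨ ∑-swap (allFin n) s _ ⟩
  ∑ s (λ e → ∑ (allFin n) (λ v → 𝟙 (lookup e v) * 𝟙 (L e)))
    ≡⟨ ∑-cong s (λ e → trans (∑-*ʳ (allFin n) (𝟙 (L e)) _) (trans (cong (_* 𝟙 (L e)) (∑-lookup e)) (trans (*-comm ∣ e ∣ _) (trans (𝟙*-cong (L e) (uni e)) (*-comm _ a))))) ⟩
  ∑ s (λ e → a * 𝟙 (L e)) ≡⟨ ∑-*ˡ s a _ ⟩
  a * size L ∎
  where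
    open ≡-Reasoning
    s = allSubsets n

∈-link : ∀ (v : Fin n) (L : Hypergraph n) e → Edge (link v L) e → lookup e v ≡ false × Edge L (e [ v ]≔ true)
∈-link v L e p with lookup e v
... | false = refl , p
∈-link v L e () | true

link-∈ : ∀ (v : Fin n) (L : Hypergraph n) e → lookup e v ≡ false → Edge L (e [ v ]≔ true) → Edge (link v L) e
link-∈ v L e q p rewrite q = p

∣insert∣ : ∀ (e : Subset n) v → lookup e v ≡ false → ∣ e [ v ]≔ true ∣ ≡ suc ∣ e ∣
∣insert∣ (false ∷ e) zero    q = refl
∣insert∣ (true  ∷ e) (suc v) q = cong suc (∣insert∣ e v q)
∣insert∣ (false ∷ e) (suc v) q = ∣insert∣ e v q

∣delete∣ : ∀ (e : Subset n) v → lookup e v ≡ true → suc ∣ e [ v ]≔ false ∣ ≡ ∣ e ∣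
∣delete∣ (true  ∷ e) zero    q = refl
∣delete∣ (true  ∷ e) (suc v) q = cong suc (∣delete∣ e v q)
∣delete∣ (false ∷ e) (suc v) q = ∣delete∣ e v q

delete-insert : ∀ (e : Subset n) v → lookup e v ≡ false → (e [ v ]≔ true) [ v ]≔ false ≡ e
delete-insert e v q = trans ([]≔-idempotent e v) (trans (cong (e [ v ]≔_) (sym q)) ([]≔-lookup e v))

-- Containment of the shadow of L in K, not equality: the link of v in the shadow of L can be larger
-- than the shadow of the link, and only containment is inherited by links.
Shadow⊆ : Hypergraph n → Hypergraph n → Set
Shadow⊆ L K = ∀ e v → Edge L e → lookup e v ≡ true → Edge K (e [ v ]≔ false)

-- A vertex w of a link edge differs from v, so deleting w commutes with inserting v.
shadow-link : ∀ {L K : Hypergraph n} v → Shadow⊆ L K → Shadow⊆ (link v L) (link v K)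
shadow-link {L = L} {K} v sh e w p q with ∈-link v L e p | w ≟ v
... | v∉e , ev∈L | yes refl = contradiction (trans (sym q) v∉e) λ ()
... | v∉e , ev∈L | no w≢v = link-∈ v K _
  (trans (lookup∘updateAt′ v w (w≢v ∘ sym) e) v∉e)
  (subst (Edge K) ([]≔-commutes e v w (w≢v ∘ sym))
    (sh (e [ v ]≔ true) w ev∈L (trans (lookup∘updateAt′ w v w≢v e) q)))

∑-insert : ∀ (e : Subset n) v → lookup e v ≡ false → (g : Fin n → ℕ) →
  ∑ (allFin n) (λ w → g w * 𝟙 (lookup (e [ v ]≔ true) w)) ≡ g v + ∑ (allFin n) (λ w → g w * 𝟙 (lookup e w))
∑-insert {suc n} (false ∷ e) zero q g = trans (∑-allFin-suc {n} _)
  (trans (eq (g zero) _) (cong (g zero +_) (sym (∑-allFin-suc (λ w → g w * 𝟙 (lookup (false ∷ e) w))))))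
  where
    eq : ∀ a b → a * 1 + b ≡ a + (a * 0 + b)
    eq = solve-∀
∑-insert {suc n} (x ∷ e) (suc v) q g = trans (∑-allFin-suc {n} _)
  (trans (cong (g zero * 𝟙 x +_) (∑-insert e v q (g ∘ suc)))
  (trans (eq (g zero * 𝟙 x) (g (suc v)) _) (cong (g (suc v) +_) (sym (∑-allFin-suc (λ w → g w * 𝟙 (lookup (x ∷ e) w)))))))
  where
    eq : ∀ a b c → a + (b + c) ≡ b + (a + c)
    eq = solve-∀

-- Kruskal–Katona for multipartite hypergraphs

-- Cauchy–Schwarz for the D c, which vanish off the m indices with M c = 1 and sum to b f.
∑-co-spread : ∀ (cs : List I) (M D E : I → ℕ) m b p f .{{_ : NonZero m}} → m ≡ b + p →
  ∑ cs M ≡ m → ∑ cs D ≡ b * f → (∀ c → M c ≤ 1) → (∀ c → D c ≤ M c * f) → (∀ c → E c + D c ≡ f) →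
  m * ∑ cs (λ c → E c * D c) ≤ b * p * (f * f)
∑-co-spread cs M D E m b p f m≡ ∑M ∑D M≤1 D≤ E+D = +-cancelʳ-≤ (b * f * (b * f)) _ _ (begin
  m * ∑ED + b * f * (b * f)      ≤⟨ +-monoʳ-≤ (m * ∑ED) cauchy ⟩
  m * ∑ED + m * ∑D²              ≡⟨ *-distribˡ-+ m ∑ED ∑D² ⟨
  m * (∑ED + ∑D²)                ≡⟨ cong₂ _*_ m≡ total ⟩
  (b + p) * (f * (b * f))        ≡⟨ eq₁ b p f ⟩
  b * p * (f * f) + b * f * (b * f) ∎)
  where
    open ≤-Reasoning
    ∑ED = ∑ cs (λ c → E c * D c)
    ∑D² = ∑ cs (λ c → D c * D c)
    eq₁ : ∀ b p f → (b + p) * (f * (b * f)) ≡ b * p * (f * f) + b * f * (b * f)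
    eq₁ = solve-∀
    eq₂ : ∀ m b f → m * (b * f * (b * f)) + m * (b * f * (b * f)) ≡ 2 * (m * (b * f)) * (b * f)
    eq₂ = solve-∀
    eq₃ : ∀ m s → m * (m * s) ≡ m * m * s
    eq₃ = solve-∀
    eq₄ : ∀ m b f D → 2 * (m * (b * f)) * D ≡ 2 * ((m * D) * (b * f))
    eq₄ = solve-∀
    eq₅ : ∀ m b f D → (m * D) * (m * D) + b * f * (b * f) ≡ m * m * (D * D) + b * f * (b * f) * 1
    eq₅ = solve-∀
    total : ∑ED + ∑D² ≡ f * (b * f)
    total = begin-equality
      ∑ED + ∑D² ≡⟨ ∑-+ cs _ _ ⟨
      ∑ cs (λ c → E c * D c + D c * D c) ≡⟨ ∑-cong cs (λ c → trans (sym (*-distribʳ-+ (D c) (E c) (D c))) (cong (_* D c) (E+D c))) ⟩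
      ∑ cs (λ c → f * D c) ≡⟨ ∑-*ˡ cs f D ⟩
      f * ∑ cs D ≡⟨ cong (f *_) ∑D ⟩
      f * (b * f) ∎
    -- This expands (m D c - b f)² ≥ 0. Where M c = 0, also D c = 0, so the constant term is charged
    -- only m times in the sum.
    pointwise : ∀ c → 2 * (m * (b * f)) * D c ≤ m * m * (D c * D c) + b * f * (b * f) * M c
    pointwise c with M c | M≤1 c | D≤ c
    ... | zero | _ | Dc≤0 rewrite n≤0⇒n≡0 Dc≤0 = ≤-trans (≤-reflexive (*-zeroʳ (2 * (m * (b * f))))) z≤n
    ... | suc zero | _ | _ = begin
      2 * (m * (b * f)) * D c ≡⟨ eq₄ m b f (D c) ⟩
      2 * ((m * D c) * (b * f)) ≤⟨ 2mn≤m²+n² (m * D c) (b * f) ⟩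
      (m * D c) * (m * D c) + b * f * (b * f) ≡⟨ eq₅ m b f (D c) ⟩
      _ ∎
    ... | suc (suc _) | s≤s () | _
    cauchy : b * f * (b * f) ≤ m * ∑D²
    cauchy = *-cancelˡ-≤ m (+-cancelʳ-≤ (m * (b * f * (b * f))) _ _ (begin
      m * (b * f * (b * f)) + m * (b * f * (b * f)) ≡⟨ eq₂ m b f ⟩
      2 * (m * (b * f)) * (b * f) ≡⟨ cong (2 * (m * (b * f)) *_) ∑D ⟨
      2 * (m * (b * f)) * ∑ cs D ≡⟨ ∑-*ˡ cs (2 * (m * (b * f))) D ⟨
      ∑ cs (λ c → 2 * (m * (b * f)) * D c) ≤⟨ ∑-mono cs pointwise ⟩
      ∑ cs (λ c → m * m * (D c * D c) + b * f * (b * f) * M c) ≡⟨ ∑-+ cs _ _ ⟩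
      ∑ cs (λ c → m * m * (D c * D c)) + ∑ cs (λ c → b * f * (b * f) * M c) ≡⟨ cong₂ _+_ (∑-*ˡ cs (m * m) _) (∑-*ˡ cs (b * f * (b * f)) M) ⟩
      m * m * ∑D² + b * f * (b * f) * ∑ cs M ≡⟨ cong₂ _+_ (sym (eq₃ m ∑D²)) (trans (cong (b * f * (b * f) *_) ∑M) (*-comm _ m)) ⟩
      m * (m * ∑D²) + m * (b * f * (b * f)) ∎))

-- A rational upper bound for the (1+β)-th root of E / C₀: when the hypothesis is an equality,
-- A (β p f + m E) / (B (1+β) p f) is its tangent line, as a function of E, at m E = p f.
root-estimate : ∀ β p m f E A B C₀ C₁ .{{_ : NonZero m}} → C₀ * m ≡ C₁ * p →
  f * B ^ suc β ≤ C₁ * A ^ suc β →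
  E * (B * (suc β * (p * f))) ^ suc β ≤ C₀ * (A * (β * (p * f) + m * E)) ^ suc β
root-estimate β p m f E A B C₀ C₁ C₀m≡C₁p hyp = *-cancelˡ-≤ m (begin
  m * (E * (B * (b * x)) ^ b)    ≡⟨ cong (λ u → m * (E * u)) (trans (^-distribʳ-* b B _) (cong (B ^ b *_) (^-distribʳ-* b b x))) ⟩
  m * (E * (B ^ b * (b ^ b * (x * x ^ β)))) ≡⟨ eq₁ m E (B ^ b) (b ^ b) p f (x ^ β) ⟩
  -- AM-GM is applied to β copies of `p * f` and one `m * E`, which agree at the point of tangency.
  p * (f * B ^ b) * (b ^ b * (x ^ β * (m * E))) ≤⟨ *-mono-≤ (*-monoʳ-≤ p hyp) (am-gm β x (m * E)) ⟩
  p * (C₁ * A ^ b) * y ^ b       ≡⟨ eq₂ p C₁ (A ^ b) (y ^ b) ⟩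
  C₁ * p * (A ^ b * y ^ b)       ≡⟨ cong₂ _*_ (sym C₀m≡C₁p) (sym (^-distribʳ-* b A y)) ⟩
  C₀ * m * (A * y) ^ b           ≡⟨ eq₃ C₀ m ((A * y) ^ b) ⟩
  m * (C₀ * (A * y) ^ b) ∎)
  where
    open ≤-Reasoning
    b = suc β
    x = p * f
    y = β * x + m * E
    eq₁ : ∀ m E B b p f x → m * (E * (B * (b * (p * f * x)))) ≡ p * (f * B) * (b * (x * (m * E)))
    eq₁ = solve-∀
    eq₂ : ∀ p c a y → p * (c * a) * y ≡ c * p * (a * y)
    eq₂ = solve-∀
    eq₃ : ∀ c m y → c * m * y ≡ m * (c * y)
    eq₃ = solve-∀

-- Shadow pairs and their vertex links

module _ (φ : Fin n → Fin k) where

  -- Counting the vertices of each colour makes `occ e c ≤ M c` say both that no colour repeats in e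
  -- and that all its colours are allowed, and it is additive under insertion.
  occ : Subset n → Fin k → ℕ
  occ e c = ∑ (allFin n) (λ v → δ (φ v) c * 𝟙 (lookup e v))

  -- M is the 0/1 indicator of the set of colours that the edges of L and K may use;
  -- there are 1 + b + p of them.
  record ShadowPair (b p : ℕ) (M : Fin k → ℕ) (L K : Hypergraph n) : Set where
    field
      M≤1       : ∀ c → M c ≤ 1
      ∑M        : ∑ (allFin k) M ≡ suc b + p
      L-uniform : IsRGraph L (suc b)
      K-uniform : IsRGraph K b
      L-rainbow : ∀ e → Edge L e → ∀ c → occ e c ≤ M c
      K-rainbow : ∀ e → Edge K e → ∀ c → occ e c ≤ M c
      shadow    : Shadow⊆ L K

  occ-insert : ∀ e v c → lookup e v ≡ false → occ (e [ v ]≔ true) c ≡ δ (φ v) c + occ e c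
  occ-insert e v c q = ∑-insert e v q (λ w → δ (φ w) c)

  rainbow-link : ∀ {M : Fin k → ℕ} {L : Hypergraph n} v → (∀ e → Edge L e → ∀ c → occ e c ≤ M c) →
                 ∀ e → Edge (link v L) e → ∀ c → occ e c ≤ M c ∸ δ (φ v) c
  rainbow-link {M} {L} v rb e p c with ∈-link v L e p
  ... | v∉e , ev∈L = m+n≤o⇒m≤o∸n (occ e c)
    (subst (_≤ M c) (trans (occ-insert e v c v∉e) (+-comm (δ (φ v) c) (occ e c))) (rb _ ev∈L c))

  uniform-link : ∀ {a} {L : Hypergraph n} v → IsRGraph L (suc a) → IsRGraph (link v L) a
  uniform-link {L = L} v uni e p with ∈-link v L e p
  ... | v∉e , ev∈L = suc-injective (trans (sym (∣insert∣ e v v∉e)) (uni _ ev∈L))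

  -- The uniformity and the number of allowed colours both drop by one, so p is unchanged. The
  -- hypothesis `M (φ v) ≡ 1` makes the truncated subtraction of the colour of v exact.
  link-pair : ∀ {b p M L K} v → M (φ v) ≡ 1 → ShadowPair (suc b) p M L K →
              ShadowPair b p (λ c → M c ∸ δ (φ v) c) (link v L) (link v K)
  link-pair {b} {p} {M} {L} {K} v Mv S = record
    { M≤1       = λ c → ≤-trans (m∸n≤m (M c) (δ (φ v) c)) (M≤1 c)
    ; ∑M        = suc-injective (begin
        1 + ∑ (allFin k) (λ c → M c ∸ δ (φ v) c)
          ≡⟨ cong (_+ ∑ (allFin k) (λ c → M c ∸ δ (φ v) c)) (trans (∑-cong (allFin k) (λ c → sym (*-identityʳ _))) (∑-δ (φ v) (λ _ → 1))) ⟨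
        ∑ (allFin k) (δ (φ v)) + ∑ (allFin k) (λ c → M c ∸ δ (φ v) c) ≡⟨ ∑-+ (allFin k) _ _ ⟨
        ∑ (allFin k) (λ c → δ (φ v) c + (M c ∸ δ (φ v) c)) ≡⟨ ∑-cong (allFin k) (λ c → m+[n∸m]≡n (δ≤M c)) ⟩
        ∑ (allFin k) M ≡⟨ ∑M ⟩
        suc (suc b) + p ∎)
    ; L-uniform = uniform-link {L = L} v L-uniform
    ; K-uniform = uniform-link {L = K} v K-uniform
    ; L-rainbow = rainbow-link {M} {L} v L-rainbow
    ; K-rainbow = rainbow-link {M} {K} v K-rainbow
    ; shadow    = shadow-link {L = L} {K} v shadow
    }
    where
      open ShadowPair S
      open ≡-Reasoning
      δ≤M : ∀ c → δ (φ v) c ≤ M c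
      δ≤M c with φ v ≟ c
      ... | yes refl = ≤-reflexive (sym Mv)
      ... | no _     = z≤n

  -- Edges meeting and avoiding a colour

  colourDegree : Hypergraph n → Fin k → ℕ
  colourDegree K c = ∑ (allFin n) (λ v → δ (φ v) c * size (link v K))

  -- In a shadow pair every edge of K has at most one vertex of colour c. Hence `1 ∸ occ e c`
  -- indicates that e avoids c, this sum is E_c, and the degree sum `colourDegree` is D_c.
  avoiding : Hypergraph n → Fin k → ℕ
  avoiding K c = ∑ (allSubsets n) (λ e → 𝟙 (K e) * (1 ∸ occ e c))

  colourDegree-occ : ∀ K c → colourDegree K c ≡ ∑ (allSubsets n) (λ e → 𝟙 (K e) * occ e c)
  colourDegree-occ K c = begin
    ∑ (allFin n) (λ v → δ (φ v) c * size (link v K))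
      ≡⟨ ∑-cong (allFin n) (λ v → trans (cong (δ (φ v) c *_) (size-link v K)) (sym (∑-*ˡ s (δ (φ v) c) _))) ⟩
    ∑ (allFin n) (λ v → ∑ s (λ e → δ (φ v) c * (𝟙 (lookup e v) * 𝟙 (K e)))) ≡⟨ ∑-swap (allFin n) s _ ⟩
    ∑ s (λ e → ∑ (allFin n) (λ v → δ (φ v) c * (𝟙 (lookup e v) * 𝟙 (K e))))
      ≡⟨ ∑-cong s (λ e → trans (∑-cong (allFin n) (λ v → eq (δ (φ v) c) (𝟙 (lookup e v)) (𝟙 (K e)))) (∑-*ˡ (allFin n) (𝟙 (K e)) _)) ⟩
    ∑ s (λ e → 𝟙 (K e) * occ e c) ∎
    where
      open ≡-Reasoning
      s = allSubsets n
      eq : ∀ a b c → a * (b * c) ≡ c * (a * b)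
      eq = solve-∀

  ∑-by-colour : ∀ K (g : Fin k → ℕ) →
    ∑ (allFin n) (λ v → g (φ v) * size (link v K)) ≡ ∑ (allFin k) (λ c → g c * colourDegree K c)
  ∑-by-colour K g = begin
    ∑ (allFin n) (λ v → g (φ v) * size (link v K))
      ≡⟨ ∑-cong (allFin n) (λ v → ∑-δ (φ v) (λ c → g c * size (link v K))) ⟨
    ∑ (allFin n) (λ v → ∑ (allFin k) (λ c → δ (φ v) c * (g c * size (link v K)))) ≡⟨ ∑-swap (allFin n) (allFin k) _ ⟩
    ∑ (allFin k) (λ c → ∑ (allFin n) (λ v → δ (φ v) c * (g c * size (link v K))))
      ≡⟨ ∑-cong (allFin k) (λ c → trans (∑-cong (allFin n) (λ v → eq (δ (φ v) c) (g c) (size (link v K)))) (∑-*ˡ (allFin n) (g c) _)) ⟩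
    ∑ (allFin k) (λ c → g c * colourDegree K c) ∎
    where
      open ≡-Reasoning
      eq : ∀ a b c → a * (b * c) ≡ b * (a * c)
      eq = solve-∀

  module _ {b p M L K} (S : ShadowPair b p M L K) where
    open ShadowPair S

    avoiding+colourDegree : ∀ c → avoiding K c + colourDegree K c ≡ size K
    avoiding+colourDegree c = begin
      avoiding K c + colourDegree K c ≡⟨ cong (avoiding K c +_) (colourDegree-occ K c) ⟩
      avoiding K c + ∑ s (λ e → 𝟙 (K e) * occ e c) ≡⟨ ∑-+ s _ _ ⟨
      ∑ s (λ e → 𝟙 (K e) * (1 ∸ occ e c) + 𝟙 (K e) * occ e c)
        ≡⟨ ∑-cong s (λ e → trans (sym (*-distribˡ-+ (𝟙 (K e)) _ _))
             (trans (𝟙*-cong (K e) (λ e∈K → m∸n+n≡m (≤-trans (K-rainbow e e∈K c) (M≤1 c)))) (*-identityʳ _))) ⟩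
      size K ∎
      where
        open ≡-Reasoning
        s = allSubsets n

    colourDegree≤ : ∀ c → colourDegree K c ≤ M c * size K
    colourDegree≤ c = begin
      colourDegree K c ≡⟨ colourDegree-occ K c ⟩
      ∑ s (λ e → 𝟙 (K e) * occ e c) ≤⟨ ∑-mono s (λ e → 𝟙*-mono (K e) (λ e∈K → K-rainbow e e∈K c)) ⟩
      ∑ s (λ e → 𝟙 (K e) * M c) ≡⟨ ∑-*ʳ s (M c) _ ⟩
      size K * M c ≡⟨ *-comm (size K) (M c) ⟩
      M c * size K ∎
      where
        open ≤-Reasoning
        s = allSubsets n

    -- The handshake identity grouped by colour; it fixes the mean of the D_c.
    ∑-colourDegree : ∑ (allFin k) (colourDegree K) ≡ b * size K
    ∑-colourDegree = begin
      ∑ (allFin k) (colourDegree K) ≡⟨ ∑-cong (allFin k) (λ c → *-identityˡ _) ⟨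
      ∑ (allFin k) (λ c → 1 * colourDegree K c) ≡⟨ ∑-by-colour K (λ _ → 1) ⟨
      ∑ (allFin n) (λ v → 1 * size (link v K)) ≡⟨ ∑-cong (allFin n) (λ v → *-identityˡ _) ⟩
      ∑ (allFin n) (λ v → size (link v K)) ≡⟨ handshake K K-uniform ⟩
      b * size K ∎
      where open ≡-Reasoning

    insert-occ≤ : ∀ v e → Edge (link v L) e → suc (occ e (φ v)) ≤ M (φ v)
    insert-occ≤ v e p with ∈-link v L e p
    ... | v∉e , ev∈L = subst (_≤ M (φ v))
      (trans (occ-insert e v (φ v) v∉e) (cong (_+ occ e (φ v)) (δ-refl (φ v)))) (L-rainbow _ ev∈L (φ v))

    -- If e is in the link of v, then e arises from an edge of L by deleting v, so it lies in K; and
    -- it avoids the colour of v, which v already uses.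
    link≤avoiding : ∀ v → size (link v L) ≤ avoiding K (φ v)
    link≤avoiding v = ∑-mono (allSubsets n) pointwise
      where
        pointwise : ∀ e → 𝟙 (link v L e) ≤ 𝟙 (K e) * (1 ∸ occ e (φ v))
        pointwise e with link v L e in p
        ... | false = z≤n
        ... | true with ∈-link v L e p
        ... | v∉e , ev∈L = ≤-reflexive (sym (cong₂ _*_ (cong 𝟙 e∈K) (cong (1 ∸_) occ≡0)))
          where
            e∈K : Edge K e
            e∈K = subst (Edge K) (delete-insert e v v∉e) (shadow _ v ev∈L (lookup∘updateAt v e))
            occ≡0 : occ e (φ v) ≡ 0
            occ≡0 = n≤0⇒n≡0 (≤-pred (≤-trans (insert-occ≤ v e p) (M≤1 (φ v))))

    link-unused : ∀ v → M (φ v) ≡ 0 → size (link v L) ≡ 0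
    link-unused v Mv = n≤0⇒n≡0 (≤-trans
      (size-mono (link v L) (λ _ → false) λ e p →
        contradiction (subst (suc (occ e (φ v)) ≤_) Mv (insert-occ≤ v e p)) λ ())
      (≤-reflexive (∑-0 (allSubsets n))))

    -- Every link of L injects into K, so an empty K makes all degrees in L vanish. This disposes of
    -- f = 0, where the tangent line has no meaning.
    size-L≡0 : size K ≡ 0 → size L ≡ 0
    size-L≡0 K≡0 = n≤0⇒n≡0 (≤-trans (m≤n*m (size L) (suc b)) (begin
      suc b * size L                        ≡⟨ handshake L L-uniform ⟨
      ∑ (allFin n) (λ v → size (link v L))  ≤⟨ ∑-mono (allFin n) (λ v → ≤-trans (link≤avoiding v)
                                                  (≤-trans (m≤m+n _ _) (≤-reflexive (trans (avoiding+colourDegree (φ v)) K≡0)))) ⟩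
      ∑ (allFin n) (λ _ → 0)                ≡⟨ ∑-0 (allFin n) ⟩
      0 ∎))
      where open ≤-Reasoning

  -- Kruskal-Katona as a bound on the ratio |L| / |K|, a form that can be summed over vertex links.
  -- With t = A/B and m = suc b + p, the bounding ratio is that of |L| = C(m, b + 1) t^(b + 1) to
  -- |K| = C(m, b) t^b. `ShadowBound` has the same conclusion but assumes that K is small instead of
  -- L.
  LocalBound : ℕ → ℕ → Set
  LocalBound b p = ∀ {M L K} → ShadowPair b p M L K → ∀ A B → NonZero B →
    size L * B ^ suc b ≤ ((suc b + p) C suc b) * A ^ suc b →
    suc b * size L * B ≤ suc p * A * size K

  ShadowBound : ℕ → ℕ → Set
  ShadowBound b p = ∀ {M L K} → ShadowPair b p M L K → ∀ A B → NonZero B →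
    size K * B ^ b ≤ ((suc b + p) C b) * A ^ b →
    suc b * size L * B ≤ suc p * A * size K

  -- For 1-uniform L the hypothesis already reads |L| ≤ m t, and a nonempty K has size at least 1.
  localBound-zero : ∀ p → LocalBound 0 p
  localBound-zero p {M} {L} {K} S A B _ hyp with size K in eq
  ... | zero  rewrite size-L≡0 S eq = z≤n
  ... | suc f = begin
    1 * size L * B    ≡⟨ eq₁ (size L) B ⟩
    size L * (B * 1)  ≤⟨ hyp ⟩
    ((1 + p) C 1) * (A * 1) ≡⟨ cong₂ _*_ (nC1≡n (suc p)) (*-identityʳ A) ⟩
    suc p * A         ≤⟨ m≤m*n (suc p * A) (suc f) ⟩
    suc p * A * suc f ∎
    where
      open ≤-Reasoning
      eq₁ : ∀ l b → 1 * l * b ≡ l * (b * 1)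
      eq₁ = solve-∀

  shadowBound-suc : ∀ β p → LocalBound β p → ShadowBound (suc β) p
  shadowBound-suc β p′ IH {M} {L} {K} S A B B≢0 hyp with size K in f≡
  ... | zero  rewrite size-L≡0 S f≡ = ≤-trans (≤-reflexive (cong (_* B) (*-zeroʳ (suc (suc β))))) z≤n
  -- One factor b is the coefficient in the induction hypothesis; `b * (p * f)` is the denominator
  -- of the tangent line.
  ... | suc f₀ = *-cancelˡ-≤ (b * b * (p * f)) (begin
    b * b * (p * f) * (suc b * size L * B)                  ≡⟨ eq₁ b p f (suc b * size L) B ⟩
    b * (B * (b * (p * f))) * (suc b * size L)              ≡⟨ cong (b * (B * (b * (p * f))) *_) (handshake L L-uniform) ⟨
    b * (B * (b * (p * f))) * ∑ V d                         ≡⟨ ∑-*ˡ V (b * (B * (b * (p * f)))) d ⟨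
    ∑ V (λ v → b * (B * (b * (p * f))) * d v)               ≤⟨ ∑-mono V vertex ⟩
    ∑ V (λ v → p * (A * (β * (p * f) + m * E (φ v))) * d′ v) ≡⟨ ∑-cong V (λ v → eq₂ p A (β * (p * f)) m (E (φ v)) (d′ v)) ⟩
    ∑ V (λ v → p * A * (β * (p * f)) * d′ v + p * A * m * (E (φ v) * d′ v)) ≡⟨ ∑-+ V _ _ ⟩
    ∑ V (λ v → p * A * (β * (p * f)) * d′ v) + ∑ V (λ v → p * A * m * (E (φ v) * d′ v))
      ≡⟨ cong₂ _+_ (∑-*ˡ V (p * A * (β * (p * f))) d′) (∑-*ˡ V (p * A * m) (λ v → E (φ v) * d′ v)) ⟩
    p * A * (β * (p * f)) * ∑ V d′ + p * A * m * ∑ V (λ v → E (φ v) * d′ v)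
      ≡⟨ cong₂ _+_ (cong (p * A * (β * (p * f)) *_) (trans (handshake K K-uniform) (cong (b *_) f≡)))
                   (trans (cong (p * A * m *_) (∑-by-colour K E)) (*-assoc (p * A) m _)) ⟩
    p * A * (β * (p * f)) * (b * f) + p * A * (m * ∑ (allFin k) (λ c → E c * colourDegree K c))
      ≤⟨ +-monoʳ-≤ (p * A * (β * (p * f)) * (b * f)) (*-monoʳ-≤ (p * A) spread) ⟩
    p * A * (β * (p * f)) * (b * f) + p * A * (b * p * (f * f)) ≡⟨ eq₃ β p A f ⟩
    b * b * (p * f) * (p * A * f)                           ∎)
    where
      open ≤-Reasoning
      open ShadowPair S
      b = suc β
      p = suc p′
      f = suc f₀
      m = suc b + p′
      V = allFin n
      d d′ : Fin n → ℕ
      d v  = size (link v L)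
      d′ v = size (link v K)
      E = avoiding K
      B′ = B * (b * (p * f))
      B′≢0 : NonZero B′
      B′≢0 = m*n≢0 B (b * (p * f)) {{B≢0}}
      eq₁ : ∀ b p f l B → b * b * (p * f) * (l * B) ≡ b * (B * (b * (p * f))) * l
      eq₁ = solve-∀
      eq₂ : ∀ p A x m E d → p * (A * (x + m * E)) * d ≡ p * A * x * d + p * A * m * (E * d)
      eq₂ = solve-∀
      eq₃ : ∀ β p A f → p * A * (β * (p * f)) * (suc β * f) + p * A * (suc β * p * (f * f))
                      ≡ suc β * suc β * (p * f) * (p * A * f)
      eq₃ = solve-∀
      eq₄ : ∀ b B d → b * B * d ≡ b * d * B
      eq₄ = solve-∀
      vertex : ∀ v → b * B′ * d v ≤ p * (A * (β * (p * f) + m * E (φ v))) * d′ v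
      vertex v with M (φ v) in Mv | M≤1 (φ v)
      ... | suc (suc _) | s≤s ()
      ... | zero        | _ rewrite link-unused S v Mv = ≤-trans (≤-reflexive (*-zeroʳ (b * B′))) z≤n
      ... | suc zero    | _ = ≤-trans (≤-reflexive (eq₄ b B′ (d v)))
        -- The link gets its own t: the value of the tangent line at E (φ v), a bound for the root
        -- of E / C(m - 1, b).
        (IH (link-pair v Mv S) (A * (β * (p * f) + m * E (φ v))) B′ B′≢0
          (≤-trans (*-monoˡ-≤ (B′ ^ b) (link≤avoiding S v))
            (root-estimate β p m f (E (φ v)) A B ((b + p′) C b) ((suc b + p′) C b) (choose-pred b p′) hyp)))
      -- The Jensen step: the right side is the value of the left when all m allowed colours have
      -- D_c = b f / m.
      spread : m * ∑ (allFin k) (λ c → E c * colourDegree K c) ≤ b * p * (f * f)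
      spread = ∑-co-spread (allFin k) M (colourDegree K) E m b p f (sym (+-suc b p′)) ∑M
        (trans (∑-colourDegree S) (cong (b *_) f≡)) M≤1
        (λ c → subst (λ x → colourDegree K c ≤ M c * x) f≡ (colourDegree≤ S c))
        (λ c → trans (avoiding+colourDegree S c) f≡)

  -- If |K| ≤ C(m, b) t^b, the shadow bound applies. Otherwise K is large while L is small by
  -- hypothesis, and dividing the two estimates gives the ratio.
  shadow⇒local : ∀ b p → ShadowBound b p → LocalBound b p
  shadow⇒local b p Q {M} {L} {K} S A B B≢0 hyp with size K * B ^ b ≤? ((suc b + p) C b) * A ^ b
  ... | yes le = Q S A B B≢0 le
  ... | no ¬le = *-cancelʳ-≤ _ _ (B ^ b) {{m^n≢0 B b {{B≢0}}}} (begin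
    suc b * size L * B * B ^ b                   ≡⟨ eq₁ (suc b) (size L) B (B ^ b) ⟩
    suc b * (size L * B ^ suc b)                 ≤⟨ *-monoʳ-≤ (suc b) hyp ⟩
    suc b * (((suc b + p) C suc b) * A ^ suc b)  ≡⟨ eq₂ (suc b) ((suc b + p) C suc b) A (A ^ b) ⟩
    ((suc b + p) C suc b) * suc b * (A * A ^ b)  ≡⟨ cong (_* (A * A ^ b)) (choose-suc b p) ⟩
    ((suc b + p) C b) * suc p * (A * A ^ b)      ≡⟨ eq₃ ((suc b + p) C b) (suc p) A (A ^ b) ⟩
    suc p * A * (((suc b + p) C b) * A ^ b)      ≤⟨ *-monoʳ-≤ (suc p * A) (≰⇒≥ ¬le) ⟩
    suc p * A * (size K * B ^ b)                 ≡⟨ *-assoc (suc p * A) (size K) (B ^ b) ⟨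
    suc p * A * size K * B ^ b                   ∎)
    where
      open ≤-Reasoning
      eq₁ : ∀ a l B c → a * l * B * c ≡ a * (l * (B * c))
      eq₁ = solve-∀
      eq₂ : ∀ a l B c → a * (l * (B * c)) ≡ l * a * (B * c)
      eq₂ = solve-∀
      eq₃ : ∀ a l B c → a * l * (B * c) ≡ l * B * (a * c)
      eq₃ = solve-∀

  localBound : ∀ b p → LocalBound b p
  localBound zero    p = localBound-zero p
  localBound (suc b) p = shadow⇒local (suc b) p (shadowBound-suc b p (localBound b p))

  -- In the notation of the header, t = A/B, a = 2 + b and m = a + p.
  partite-kruskal-katona : ∀ {b p M L K} → ShadowPair (suc b) p M L K → ∀ A B → NonZero B →
    ((suc (suc b) + p) C suc (suc b)) * A ^ suc (suc b) < size L * B ^ suc (suc b) →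
    ((suc (suc b) + p) C suc b) * A ^ suc b < size K * B ^ suc b
  partite-kruskal-katona {b₀} {p} {M} {L} {K} S A B B≢0 hyp = ≰⇒> λ le → <⇒≱ hyp
    (*-cancelˡ-≤ (suc b) (begin
    suc b * (size L * B ^ suc b)                 ≡⟨ eq₁ (suc b) (size L) B (B ^ b) ⟩
    -- The negated conclusion `le` enters twice: here as the hypothesis of the ratio bound, and
    -- below to bound |K| itself.
    suc b * size L * B * B ^ b                   ≤⟨ *-monoˡ-≤ (B ^ b) (shadowBound-suc b₀ p (localBound b₀ p) S A B B≢0 le) ⟩
    suc p * A * size K * B ^ b                   ≡⟨ *-assoc (suc p * A) (size K) (B ^ b) ⟩
    suc p * A * (size K * B ^ b)                 ≤⟨ *-monoʳ-≤ (suc p * A) le ⟩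
    suc p * A * (((suc b + p) C b) * A ^ b)      ≡⟨ eq₃ ((suc b + p) C b) (suc p) A (A ^ b) ⟩
    ((suc b + p) C b) * suc p * (A * A ^ b)      ≡⟨ cong (_* (A * A ^ b)) (choose-suc b p) ⟨
    ((suc b + p) C suc b) * suc b * (A * A ^ b)  ≡⟨ eq₂ (suc b) ((suc b + p) C suc b) A (A ^ b) ⟩
    suc b * (((suc b + p) C suc b) * A ^ suc b)  ∎))
    where
      open ≤-Reasoning
      b = suc b₀
      eq₁ : ∀ a l B c → a * (l * (B * c)) ≡ a * l * B * c
      eq₁ = solve-∀
      eq₂ : ∀ a l B c → l * a * (B * c) ≡ a * (l * (B * c))
      eq₂ = solve-∀
      eq₃ : ∀ a l B c → l * B * (a * c) ≡ a * l * (B * c)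
      eq₃ = solve-∀

-- Clearing denominators

toℚᵘ-ℕ→ℚ : ∀ n → toℚᵘ (ℕ→ℚ n) ≃ mkℚᵘ (ℤ.+ n) 0
toℚᵘ-ℕ→ℚ n = ℚ.toℚᵘ-fromℚᵘ (mkℚᵘ (ℤ.+ n) 0)

ℕ→ℚ-* : ∀ m n → ℕ→ℚ (m * n) ≡ ℕ→ℚ m ℚ.* ℕ→ℚ n
ℕ→ℚ-* m n = ℚ.toℚᵘ-injective (begin
  toℚᵘ (ℕ→ℚ (m * n))             ≈⟨ toℚᵘ-ℕ→ℚ (m * n) ⟩
  mkℚᵘ (ℤ.+ (m * n)) 0             ≈⟨ *≡* (cong (ℤ._* ℤ.+ 1) (ℤ.pos-* m n)) ⟩
  mkℚᵘ (ℤ.+ m) 0 ℚᵘ.* mkℚᵘ (ℤ.+ n) 0   ≈⟨ ℚᵘ.*-cong (toℚᵘ-ℕ→ℚ m) (toℚᵘ-ℕ→ℚ n) ⟨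
  toℚᵘ (ℕ→ℚ m) ℚᵘ.* toℚᵘ (ℕ→ℚ n)   ≈⟨ ℚ.toℚᵘ-homo-* (ℕ→ℚ m) (ℕ→ℚ n) ⟨
  toℚᵘ (ℕ→ℚ m ℚ.* ℕ→ℚ n)             ∎)
  where open ℚᵘ.≃-Reasoning

ℕ→ℚ-mono-< : ∀ {m n} → m < n → ℕ→ℚ m ℚ.< ℕ→ℚ n
ℕ→ℚ-mono-< {m} {n} m<n = ℚ.toℚᵘ-cancel-<
  (ℚᵘ.<-respˡ-≃ (ℚᵘ.≃-sym (toℚᵘ-ℕ→ℚ m)) (ℚᵘ.<-respʳ-≃ (ℚᵘ.≃-sym (toℚᵘ-ℕ→ℚ n))
    (*<* (ℤ.*-monoʳ-<-pos (ℤ.+ 1) (ℤ.+<+ m<n)))))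

ℕ→ℚ-cancel-< : ∀ {m n} → ℕ→ℚ m ℚ.< ℕ→ℚ n → m < n
ℕ→ℚ-cancel-< {m} {n} m<n with ℚᵘ.<-respˡ-≃ (toℚᵘ-ℕ→ℚ m) (ℚᵘ.<-respʳ-≃ (toℚᵘ-ℕ→ℚ n) (ℚ.toℚᵘ-mono-< m<n))
... | *<* lt = ℤ.drop‿+<+ (ℤ.*-cancelʳ-<-nonNeg (ℤ.+ 1) lt)

ℕ→ℚ-positive : ∀ n .{{_ : NonZero n}} → Positive (ℕ→ℚ n)
ℕ→ℚ-positive (suc n) = ℚ.positive (ℕ→ℚ-mono-< {0} {suc n} (s≤s z≤n))

fraction : ∀ q → 0ℚ ℚ.≤ q → ∃₂ λ A B → NonZero B × q ℚ.* ℕ→ℚ B ≡ ℕ→ℚ A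
fraction (mkℚ (ℤ.+ A) B-1 c) _ = A , suc B-1 , _ , ℚ.toℚᵘ-injective (begin
  toℚᵘ (mkℚ (ℤ.+ A) B-1 c ℚ.* ℕ→ℚ (suc B-1))        ≈⟨ ℚ.toℚᵘ-homo-* (mkℚ (ℤ.+ A) B-1 c) (ℕ→ℚ (suc B-1)) ⟩
  mkℚᵘ (ℤ.+ A) B-1 ℚᵘ.* toℚᵘ (ℕ→ℚ (suc B-1))      ≈⟨ ℚᵘ.*-congˡ {mkℚᵘ (ℤ.+ A) B-1} (toℚᵘ-ℕ→ℚ (suc B-1)) ⟩
  mkℚᵘ (ℤ.+ A) B-1 ℚᵘ.* mkℚᵘ (ℤ.+ suc B-1) 0        ≈⟨ *≡* (trans (ℤ.*-identityʳ _) (cong (λ x → ℤ.+ A ℤ.* ℤ.+ x) (sym (*-identityʳ (suc B-1))))) ⟩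
  mkℚᵘ (ℤ.+ A) 0                                  ≈⟨ toℚᵘ-ℕ→ℚ A ⟨
  toℚᵘ (ℕ→ℚ A)                                  ∎)
  where open ℚᵘ.≃-Reasoning
fraction (mkℚ -[1+ _ ] _ _) (*≤* ())

^ℚ-fraction : ∀ q A B → q ℚ.* ℕ→ℚ B ≡ ℕ→ℚ A → ∀ a → q ^ℚ a ℚ.* ℕ→ℚ (B ^ a) ≡ ℕ→ℚ (A ^ a)
^ℚ-fraction q A B eq zero    = ℚ.*-identityˡ _
^ℚ-fraction q A B eq (suc a) = begin
  q ℚ.* q ^ℚ a ℚ.* ℕ→ℚ (B * B ^ a)            ≡⟨ cong (q ℚ.* q ^ℚ a ℚ.*_) (ℕ→ℚ-* B _) ⟩
  q ℚ.* q ^ℚ a ℚ.* (ℕ→ℚ B ℚ.* ℕ→ℚ (B ^ a))        ≡⟨ interchange q _ _ _ ⟩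
  q ℚ.* ℕ→ℚ B ℚ.* (q ^ℚ a ℚ.* ℕ→ℚ (B ^ a))        ≡⟨ cong₂ ℚ._*_ eq (^ℚ-fraction q A B eq a) ⟩
  ℕ→ℚ A ℚ.* ℕ→ℚ (A ^ a)                       ≡⟨ ℕ→ℚ-* A _ ⟨
  ℕ→ℚ (A * A ^ a)                         ∎
  where open ≡-Reasoning

module _ {q A B} .{{_ : NonZero B}} (qB≡A : q ℚ.* ℕ→ℚ B ≡ ℕ→ℚ A) (X n a D : ℕ) where

  private
    threshold : ℚ
    threshold = ℕ→ℚ X ℚ.* q ^ℚ a ℚ.* ℕ→ℚ (n ^ a)
    cleared : threshold ℚ.* ℕ→ℚ (B ^ a) ≡ ℕ→ℚ (X * (A * n) ^ a)
    cleared = begin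
      ℕ→ℚ X ℚ.* q ^ℚ a ℚ.* ℕ→ℚ (n ^ a) ℚ.* ℕ→ℚ (B ^ a)   ≡⟨ xy∙z≈xz∙y (ℕ→ℚ X ℚ.* q ^ℚ a) _ _ ⟩
      ℕ→ℚ X ℚ.* q ^ℚ a ℚ.* ℕ→ℚ (B ^ a) ℚ.* ℕ→ℚ (n ^ a)   ≡⟨ cong (ℚ._* ℕ→ℚ (n ^ a)) (trans (ℚ.*-assoc (ℕ→ℚ X) _ _) (cong (ℕ→ℚ X ℚ.*_) (^ℚ-fraction q A B qB≡A a))) ⟩
      ℕ→ℚ X ℚ.* ℕ→ℚ (A ^ a) ℚ.* ℕ→ℚ (n ^ a)            ≡⟨ trans (ℚ.*-assoc (ℕ→ℚ X) _ _) (cong (ℕ→ℚ X ℚ.*_) (sym (ℕ→ℚ-* (A ^ a) (n ^ a)))) ⟩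
      ℕ→ℚ X ℚ.* ℕ→ℚ (A ^ a * n ^ a)                ≡⟨ ℕ→ℚ-* X _ ⟨
      ℕ→ℚ (X * (A ^ a * n ^ a))                ≡⟨ cong (λ x → ℕ→ℚ (X * x)) (^-distribʳ-* a A n) ⟨
      ℕ→ℚ (X * (A * n) ^ a)                      ∎
      where open ≡-Reasoning
    instance
      _ = ℕ→ℚ-positive (B ^ a) {{m^n≢0 B a}}

  -- Multiply by B^a > 0. The factor n^a joins A^a, so the integer form has t = q n = A n / B.
  threshold⇒ℕ : threshold ℚ.< ℕ→ℚ D → X * (A * n) ^ a < D * B ^ a
  threshold⇒ℕ lt = ℕ→ℚ-cancel-< (subst₂ ℚ._<_ cleared (sym (ℕ→ℚ-* D (B ^ a)))
    (ℚ.*-monoˡ-<-pos (ℕ→ℚ (B ^ a)) lt))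

  ℕ⇒threshold : X * (A * n) ^ a < D * B ^ a → threshold ℚ.< ℕ→ℚ D
  ℕ⇒threshold lt = ℚ.*-cancelʳ-<-nonNeg (ℕ→ℚ (B ^ a)) {{ℚ.pos⇒nonNeg (ℕ→ℚ (B ^ a))}}
    (subst₂ ℚ._<_ (sym cleared) (ℕ→ℚ-* D (B ^ a)) (ℕ→ℚ-mono-< lt))

-- The shadow graph

∧-true : ∀ {b c} → b ∧ c ≡ true → b ≡ true × c ≡ true
∧-true {true} p = refl , p

does-true : ∀ {P : Set} (P? : Dec P) → does P? ≡ true → P
does-true (yes p) _ = p

≡ᵇ-true⇒≡ : ∀ {m n} → (m ≡ᵇ n) ≡ true → m ≡ n
≡ᵇ-true⇒≡ {m} {n} p = ≡ᵇ⇒≡ m n (subst T (sym p) _)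

≡⇒≡ᵇ-true : ∀ {m n} → m ≡ n → (m ≡ᵇ n) ≡ true
≡⇒≡ᵇ-true {zero}  refl = refl
≡⇒≡ᵇ-true {suc m} refl = ≡⇒≡ᵇ-true {m} refl

-- Turns injectivity of a colouring on an edge into the count `occ≤1`.
∑≤1 : (g : Fin n → ℕ) → (∀ v → g v ≤ 1) → (∀ v w → 0 < g v → 0 < g w → v ≡ w) → ∑ (allFin n) g ≤ 1
∑≤1 {zero}  g g≤1 inj = z≤n
∑≤1 {suc n} g g≤1 inj = ≤-trans (≤-reflexive (∑-allFin-suc g)) bound
  where
    bound : g zero + ∑ (allFin n) (g ∘ suc) ≤ 1
    bound with g zero in g0
    ... | zero  = ∑≤1 (g ∘ suc) (g≤1 ∘ suc) λ v w p q → Fin.suc-injective (inj (suc v) (suc w) p q)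
    ... | suc x = ≤-trans (≤-reflexive (trans (cong (suc x +_) rest) (+-identityʳ (suc x)))) (subst (_≤ 1) g0 (g≤1 zero))
      where
        rest : ∑ (allFin n) (g ∘ suc) ≡ 0
        rest = trans (∑-cong (allFin n) λ v → n≤0⇒n≡0 (≮⇒≥ λ p →
          contradiction (inj zero (suc v) (subst (0 <_) (sym g0) (s≤s z≤n)) p) λ ())) (∑-0 (allFin n))

disjoint-lookup : ∀ (s t : Subset n) v → disjointᵇ s t ≡ true → lookup s v ≡ true → lookup t v ≡ true → ⊥
disjoint-lookup (true  ∷ s) (true  ∷ t) zero    () _ _
disjoint-lookup (true  ∷ s) (false ∷ t) zero    _ _ ()
disjoint-lookup (false ∷ s) (_     ∷ t) zero    _ () _
disjoint-lookup (true  ∷ s) (false ∷ t) (suc v) d p q = disjoint-lookup s t v d p q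
disjoint-lookup (false ∷ s) (_     ∷ t) (suc v) d p q = disjoint-lookup s t v d p q

disjoint-delete : ∀ (s t : Subset n) v → disjointᵇ s t ≡ true → disjointᵇ s (t [ v ]≔ false) ≡ true
disjoint-delete (true  ∷ s) (false ∷ t) zero    d = d
disjoint-delete (false ∷ s) (_     ∷ t) zero    d = d
disjoint-delete (true  ∷ s) (false ∷ t) (suc v) d = disjoint-delete s t v d
disjoint-delete (false ∷ s) (_     ∷ t) (suc v) d = disjoint-delete s t v d

∣disjoint-∪∣ : ∀ (s t : Subset n) → disjointᵇ s t ≡ true → ∣ s ∪ t ∣ ≡ ∣ s ∣ + ∣ t ∣
∣disjoint-∪∣ []          []          d = refl
∣disjoint-∪∣ (true  ∷ s) (false ∷ t) d = cong suc (∣disjoint-∪∣ s t d)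
∣disjoint-∪∣ (false ∷ s) (true  ∷ t) d = trans (cong suc (∣disjoint-∪∣ s t d)) (sym (+-suc ∣ s ∣ ∣ t ∣))
∣disjoint-∪∣ (false ∷ s) (false ∷ t) d = ∣disjoint-∪∣ s t d

delete-⊆ : ∀ (t : Subset n) v → t [ v ]≔ false ⊆ t
delete-⊆ t v {w} w∈ with w ≟ v
... | yes refl = contradiction (trans (sym ([]=⇒lookup w∈)) (lookup∘updateAt v t)) λ ()
... | no w≢v   = lookup⇒[]= w t (trans (sym (lookup∘updateAt′ w v w≢v t)) ([]=⇒lookup w∈))

∪-monoʳ-⊆ : ∀ (s : Subset n) {t t′} → t ⊆ t′ → s ∪ t ⊆ s ∪ t′
∪-monoʳ-⊆ s {t} {t′} t⊆t′ w∈ with x∈p∪q⁻ s t w∈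
... | inj₁ w∈s = p⊆p∪q t′ w∈s
... | inj₂ w∈t = q⊆p∪q s t′ (t⊆t′ w∈t)

subset-of-size : ∀ (e : Subset n) j → j ≤ ∣ e ∣ → ∃ λ f → f ⊆ e × ∣ f ∣ ≡ j
subset-of-size []          zero    _ = [] , ⊆-refl , refl
subset-of-size (false ∷ e) j       j≤ with subset-of-size e j j≤
... | f , f⊆e , ∣f∣ = false ∷ f , out⊆ f⊆e , ∣f∣
subset-of-size (true ∷ e)  zero    _ with subset-of-size e 0 z≤n
... | f , f⊆e , ∣f∣ = false ∷ f , out⊆ f⊆e , ∣f∣
subset-of-size (true ∷ e)  (suc j) (s≤s j≤) with subset-of-size e j j≤
... | f , f⊆e , ∣f∣ = true ∷ f , s⊆s f⊆e , cong suc ∣f∣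

subset-through : ∀ (e : Subset n) {v} → v ∈ e → ∀ j → 1 ≤ j → j ≤ ∣ e ∣ → ∃ λ f → f ⊆ e × ∣ f ∣ ≡ j × v ∈ f
subset-through (true ∷ e) here (suc j) _ (s≤s j≤) with subset-of-size e j j≤
... | f , f⊆e , ∣f∣ = true ∷ f , s⊆s f⊆e , cong suc ∣f∣ , here
subset-through (false ∷ e) (there v∈e) j 1≤j j≤ with subset-through e v∈e j 1≤j j≤
... | f , f⊆e , ∣f∣ , v∈f = false ∷ f , out⊆ f⊆e , ∣f∣ , there v∈f
-- The first vertex is dropped whenever enough others remain; otherwise j is the full size and the
-- whole set is taken.
subset-through (true ∷ e) (there v∈e) j 1≤j j≤ with m≤n⇒m<n∨m≡n j≤
... | inj₂ j≡ = true ∷ e , ⊆-refl , sym j≡ , there v∈e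
... | inj₁ (s≤s j≤′) with subset-through e v∈e j 1≤j j≤′
... | f , f⊆e , ∣f∣ , v∈f = false ∷ f , out⊆ f⊆e , ∣f∣ , there v∈f

-- The downward closure and its links

Covered : Hypergraph n → Subset n → Set
Covered H e = ∃ λ f → Edge H f × e ⊆ f

covered? : ∀ (H : Hypergraph n) e → Dec (Covered H e)
covered? H e = anySubset? (λ f → (H f Bool.≟ true) ×-dec (e ⊆? f))

coveredᵇ : Hypergraph n → Hypergraph n
coveredᵇ H e = does (covered? H e)

shadowGraph : ℕ → Hypergraph n → Hypergraph n
shadowGraph r H e = (∣ e ∣ ≡ᵇ r) ∧ coveredᵇ H e

∈-shadowGraph : ∀ {r} (H : Hypergraph n) e → Edge (shadowGraph r H) e → ∣ e ∣ ≡ r × Covered H e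
∈-shadowGraph H e p with ∧-true p
... | q , c = ≡ᵇ-true⇒≡ q , does-true (covered? H e) c

shadowGraph-∈ : ∀ {r} (H : Hypergraph n) e → ∣ e ∣ ≡ r → Covered H e → Edge (shadowGraph r H) e
shadowGraph-∈ H e q c = cong₂ _∧_ (≡⇒≡ᵇ-true q) (dec-true (covered? H e) c)

-- Two vertices in an edge of the shadow graph lie together in an edge of H, so they have different
-- colours.
shadowGraph-coloring : ∀ {r} (H : Hypergraph n) (φ : Fin n → Fin k) → IsColoring H k φ → IsColoring (shadowGraph r H) k φ
shadowGraph-coloring H φ col e e∈ u v u∈ v∈ with ∈-shadowGraph H e e∈
... | _ , f , f∈H , e⊆f = col f f∈H u v (e⊆f u∈) (e⊆f v∈)

degᵇ : Hypergraph n → ℕ → Subset n → Hypergraph n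
degᵇ H d S T = (∣ T ∣ ≡ᵇ d) ∧ disjointᵇ S T ∧ H (S ∪ T)

deg≡size : ∀ (H : Hypergraph n) r S → deg H r S ≡ size (degᵇ H (r ∸ ∣ S ∣) S)
deg≡size {n} H r S = length-filter-∑ (degᵇ H (r ∸ ∣ S ∣) S) _ (allSubsets n)

∈-degᵇ : ∀ (H : Hypergraph n) d S T → Edge (degᵇ H d S) T → ∣ T ∣ ≡ d × disjointᵇ S T ≡ true × Edge H (S ∪ T)
∈-degᵇ H d S T p with ∧-true p
... | q , p′ with ∧-true p′
... | dis , c = ≡ᵇ-true⇒≡ q , dis , c

degᵇ-∈ : ∀ (H : Hypergraph n) d S T → ∣ T ∣ ≡ d → disjointᵇ S T ≡ true → Edge H (S ∪ T) → Edge (degᵇ H d S) T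
degᵇ-∈ H d S T q dis c = cong₂ _∧_ (≡⇒≡ᵇ-true q) (cong₂ _∧_ dis c)

module _ (H : Hypergraph n) (φ : Fin n → Fin k) (col : IsColoring H k φ) where

  occ≤1 : ∀ f → Edge H f → ∀ c → occ φ f c ≤ 1
  occ≤1 f f∈H c = ∑≤1 _ (λ v → bound v) λ v w p q →
    col f f∈H v w (proj₂ (pos v p)) (proj₂ (pos w q)) (trans (proj₁ (pos v p)) (sym (proj₁ (pos w q))))
    where
      bound : ∀ v → δ (φ v) c * 𝟙 (lookup f v) ≤ 1
      bound v = *-mono-≤ (𝟙-mono (does (φ v ≟ c)) true λ _ → refl) (𝟙-mono (lookup f v) true λ _ → refl)
      pos : ∀ v → 0 < δ (φ v) c * 𝟙 (lookup f v) → φ v ≡ c × v ∈ f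
      pos v p with φ v ≟ c | lookup f v in q
      pos v p  | yes e | true = e , lookup⇒[]= v f q

  occ-disjoint : ∀ S T f → disjointᵇ S T ≡ true → S ∪ T ⊆ f → ∀ c → occ φ S c + occ φ T c ≤ occ φ f c
  occ-disjoint S T f dis ST⊆f c = ≤-trans (≤-reflexive (sym (∑-+ (allFin n) _ _)))
    (∑-mono (allFin n) λ v → ≤-trans (≤-reflexive (sym (*-distribˡ-+ (δ (φ v) c) _ _))) (*-monoʳ-≤ (δ (φ v) c) (indicator v)))
    where
      in-f : ∀ v → v ∈ S ∪ T → 1 ≤ 𝟙 (lookup f v)
      in-f v v∈ = ≤-reflexive (sym (cong 𝟙 ([]=⇒lookup (ST⊆f v∈))))
      indicator : ∀ v → 𝟙 (lookup S v) + 𝟙 (lookup T v) ≤ 𝟙 (lookup f v)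
      indicator v with lookup S v in s | lookup T v in t
      ... | false | false = z≤n
      ... | true  | true  = contradiction t (disjoint-lookup S T v dis s)
      ... | true  | false = in-f v (p⊆p∪q T (lookup⇒[]= v S s))
      ... | false | true  = in-f v (q⊆p∪q S T (lookup⇒[]= v T t))

  module _ (S : Subset n) (S-covered : Covered H S) where

    freeColours : Fin k → ℕ
    freeColours c = 1 ∸ occ φ S c

    -- Level d of the link of S in the downward closure of H. The levels interpolate between the
    -- links of S in H and in the shadow graph.
    layer : ℕ → Hypergraph n
    layer d = degᵇ (coveredᵇ H) d S

    ∈-layer : ∀ d T → Edge (layer d) T → ∣ T ∣ ≡ d × disjointᵇ S T ≡ true × Covered H (S ∪ T)
    ∈-layer d T p with ∈-degᵇ (coveredᵇ H) d S T p
    ... | q , dis , c = q , dis , does-true (covered? H (S ∪ T)) c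

    layer-∈ : ∀ d T → ∣ T ∣ ≡ d → disjointᵇ S T ≡ true → Covered H (S ∪ T) → Edge (layer d) T
    layer-∈ d T q dis c = degᵇ-∈ (coveredᵇ H) d S T q dis (dec-true (covered? H (S ∪ T)) c)

    layer-rainbow : ∀ d T → Edge (layer d) T → ∀ c → occ φ T c ≤ freeColours c
    layer-rainbow d T p c with ∈-layer d T p
    ... | _ , dis , f , f∈H , ST⊆f = m+n≤o⇒m≤o∸n (occ φ T c) (begin
      occ φ T c + occ φ S c ≡⟨ +-comm (occ φ T c) _ ⟩
      occ φ S c + occ φ T c ≤⟨ occ-disjoint S T f dis ST⊆f c ⟩
      occ φ f c             ≤⟨ occ≤1 f f∈H c ⟩
      1                     ∎)
      where open ≤-Reasoning

    occ-S≤1 : ∀ c → occ φ S c ≤ 1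
    occ-S≤1 c = let f , f∈H , S⊆f = S-covered in ≤-trans (∑-mono (allFin n) λ v → *-monoʳ-≤ (δ (φ v) c)
      (𝟙-mono _ _ λ v∈S → []=⇒lookup (S⊆f (lookup⇒[]= v S v∈S)))) (occ≤1 f f∈H c)

    ∑-occ : ∑ (allFin k) (occ φ S) ≡ ∣ S ∣
    ∑-occ = begin
      ∑ (allFin k) (λ c → ∑ (allFin n) (λ v → δ (φ v) c * 𝟙 (lookup S v))) ≡⟨ ∑-swap (allFin k) (allFin n) _ ⟩
      ∑ (allFin n) (λ v → ∑ (allFin k) (λ c → δ (φ v) c * 𝟙 (lookup S v))) ≡⟨ ∑-cong (allFin n) (λ v → ∑-δ (φ v) (λ _ → 𝟙 (lookup S v))) ⟩
      ∑ (allFin n) (𝟙 ∘ lookup S) ≡⟨ ∑-lookup S ⟩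
      ∣ S ∣ ∎
      where open ≡-Reasoning

    ∑-freeColours : ∑ (allFin k) freeColours ≡ k ∸ ∣ S ∣
    ∑-freeColours = begin
      ∑ (allFin k) freeColours                     ≡⟨ m+n∸n≡m _ ∣ S ∣ ⟨
      ∑ (allFin k) freeColours + ∣ S ∣ ∸ ∣ S ∣       ≡⟨ cong (λ x → ∑ (allFin k) freeColours + x ∸ ∣ S ∣) ∑-occ ⟨
      ∑ (allFin k) freeColours + ∑ (allFin k) (occ φ S) ∸ ∣ S ∣ ≡⟨ cong (_∸ ∣ S ∣) (∑-+ (allFin k) _ _) ⟨
      ∑ (allFin k) (λ c → freeColours c + occ φ S c) ∸ ∣ S ∣ ≡⟨ cong (_∸ ∣ S ∣) (∑-cong (allFin k) (λ c → m∸n+n≡m (occ-S≤1 c))) ⟩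
      ∑ (allFin k) (λ _ → 1) ∸ ∣ S ∣                ≡⟨ cong (_∸ ∣ S ∣) (∑-allFin-1 k) ⟩
      k ∸ ∣ S ∣                                     ∎
      where open ≡-Reasoning

    layer-pair : ∀ b p → k ∸ ∣ S ∣ ≡ suc b + p → ShadowPair φ b p freeColours (layer (suc b)) (layer b)
    layer-pair b p m≡ = record
      { M≤1       = λ c → m∸n≤m 1 (occ φ S c)
      ; ∑M        = trans ∑-freeColours m≡
      ; L-uniform = λ T p → proj₁ (∈-layer (suc b) T p)
      ; K-uniform = λ T p → proj₁ (∈-layer b T p)
      ; L-rainbow = layer-rainbow (suc b)
      ; K-rainbow = layer-rainbow b
      ; shadow    = shadow
      }
      where
        shadow : Shadow⊆ (layer (suc b)) (layer b)
        shadow T v p v∈T with ∈-layer (suc b) T p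
        ... | ∣T∣ , dis , f , f∈H , ST⊆f = layer-∈ b (T [ v ]≔ false)
          (suc-injective (trans (∣delete∣ T v v∈T) ∣T∣)) (disjoint-delete S T v dis)
          (f , f∈H , ST⊆f ∘ ∪-monoʳ-⊆ S (delete-⊆ T v))

    -- Each of the j steps passes from one layer to the next lower one, lowering the uniformity and
    -- raising p by one, so that m and t = A/B stay fixed.
    layer-descent : ∀ A B → NonZero B → ∀ j b p m → m ≡ k ∸ ∣ S ∣ → m ≡ suc (j + b) + p →
      (m C suc (j + b)) * A ^ suc (j + b) < size (layer (suc (j + b))) * B ^ suc (j + b) →
      (m C suc b) * A ^ suc b < size (layer (suc b)) * B ^ suc b
    layer-descent A B B≢0 zero    b p m _  _    lt = lt
    layer-descent A B B≢0 (suc j) b p m m≡ refl lt =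
      layer-descent A B B≢0 j b (suc p) m m≡ (sym (+-suc (suc (j + b)) p))
        (partite-kruskal-katona φ (layer-pair (suc (j + b)) p (sym m≡)) A B B≢0 lt)

-- The degree of S in H is at most the size of layer r₁ - i, and layer r₂ - i is at most its degree
-- in the shadow graph; `layer-descent` joins the two.
shadow-degree : ∀ (H : Hypergraph n) (φ : Fin n → Fin k) → IsColoring H k φ →
  ∀ {i r₁ r₂} → i < r₂ → r₂ ≤ r₁ → r₁ ≤ k → ∀ A B → NonZero B → ∀ S → InShadow H i S →
  ((k ∸ i) C (r₁ ∸ i)) * A ^ (r₁ ∸ i) < deg H r₁ S * B ^ (r₁ ∸ i) →
  ((k ∸ i) C (r₂ ∸ i)) * A ^ (r₂ ∸ i) < deg (shadowGraph r₂ H) r₂ S * B ^ (r₂ ∸ i)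
shadow-degree {n} {k} H φ col {i} {r₁} {r₂} i<r₂ r₂≤r₁ r₁≤k A B B≢0 S (refl , cov) lt =
  ≤-trans (subst (λ d → ((k ∸ i) C d) * A ^ d < size (layer H φ col S cov d) * B ^ d) (sym d₂≡)
    (layer-descent H φ col S cov A B B≢0 (r₁ ∸ r₂) (r₂ ∸ suc i) (k ∸ r₁) (k ∸ i) refl k≡
      (subst (λ d → ((k ∸ i) C d) * A ^ d < size (layer H φ col S cov d) * B ^ d) d₁≡
        (≤-trans lt (*-monoˡ-≤ (B ^ (r₁ ∸ i)) top)))))
    (*-monoˡ-≤ (B ^ (r₂ ∸ i)) bottom)
  where
    d₂≡ : r₂ ∸ i ≡ suc (r₂ ∸ suc i)
    d₂≡ = +-∸-assoc 1 i<r₂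
    d₁≡ : r₁ ∸ i ≡ suc (r₁ ∸ r₂ + (r₂ ∸ suc i))
    d₁≡ = begin
      r₁ ∸ i                          ≡⟨ cong (_∸ i) (m∸n+n≡m r₂≤r₁) ⟨
      r₁ ∸ r₂ + r₂ ∸ i                ≡⟨ +-∸-assoc (r₁ ∸ r₂) (<⇒≤ i<r₂) ⟩
      r₁ ∸ r₂ + (r₂ ∸ i)              ≡⟨ cong (r₁ ∸ r₂ +_) d₂≡ ⟩
      r₁ ∸ r₂ + suc (r₂ ∸ suc i)      ≡⟨ +-suc (r₁ ∸ r₂) _ ⟩
      suc (r₁ ∸ r₂ + (r₂ ∸ suc i))    ∎
      where open ≡-Reasoning
    i≤r₁ = ≤-trans (<⇒≤ i<r₂) r₂≤r₁
    k≡ : k ∸ i ≡ suc (r₁ ∸ r₂ + (r₂ ∸ suc i)) + (k ∸ r₁)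
    k≡ = begin
      k ∸ i                    ≡⟨ cong (_∸ i) (m∸n+n≡m r₁≤k) ⟨
      k ∸ r₁ + r₁ ∸ i          ≡⟨ +-∸-assoc (k ∸ r₁) i≤r₁ ⟩
      k ∸ r₁ + (r₁ ∸ i)        ≡⟨ +-comm (k ∸ r₁) _ ⟩
      r₁ ∸ i + (k ∸ r₁)        ≡⟨ cong (_+ (k ∸ r₁)) d₁≡ ⟩
      _                        ∎
      where open ≡-Reasoning
    top : deg H r₁ S ≤ size (layer H φ col S cov (r₁ ∸ i))
    top = ≤-trans (≤-reflexive (deg≡size H r₁ S)) (size-mono _ _ λ T p →
      let q , dis , ST∈H = ∈-degᵇ H (r₁ ∸ i) S T p
      in layer-∈ H φ col S cov (r₁ ∸ i) T q dis (S ∪ T , ST∈H , ⊆-refl))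
    bottom : size (layer H φ col S cov (r₂ ∸ i)) ≤ deg (shadowGraph r₂ H) r₂ S
    bottom = ≤-trans (size-mono _ _ λ T p →
      let q , dis , c = ∈-layer H φ col S cov (r₂ ∸ i) T p
      in degᵇ-∈ (shadowGraph r₂ H) (r₂ ∸ i) S T q dis (shadowGraph-∈ H (S ∪ T)
           (trans (∣disjoint-∪∣ S T dis) (trans (cong (i +_) q) (m+[n∸m]≡n (<⇒≤ i<r₂)))) c))
      (≤-reflexive (sym (deg≡size (shadowGraph r₂ H) r₂ S)))

minPosDeg-weaken : ∀ (H : Hypergraph n) r i {c d} → c ℚ.≤ d → MinPosDegGt H r i d → MinPosDegGt H r i c
minPosDeg-weaken {n} H r i c≤d δ⁺ S S∈ = ℚ.≤-<-trans
  (ℚ.*-monoʳ-≤-nonNeg (ℕ→ℚ (n ^ (r ∸ i))) {{ℚ.normalize-nonNeg (n ^ (r ∸ i)) 1}} c≤d) (δ⁺ S S∈)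

InShadow-shadowGraph : ∀ {r i} (H : Hypergraph n) S → InShadow (shadowGraph r H) i S → InShadow H i S
InShadow-shadowGraph H S (∣S∣ , e , e∈H′ , S⊆e) with ∈-shadowGraph H e e∈H′
... | _ , f , f∈H , e⊆f = ∣S∣ , f , f∈H , e⊆f ∘ S⊆e

noIsolated-shadowGraph : ∀ {r₁ r₂} (H : Hypergraph n) → 1 ≤ r₂ → r₂ ≤ r₁ → IsRGraph H r₁ →
                         NoIsolated H → NoIsolated (shadowGraph r₂ H)
noIsolated-shadowGraph {r₂ = r₂} H 1≤r₂ r₂≤r₁ uni noIso v with noIso v
... | e , e∈H , v∈e with subset-through e v∈e r₂ 1≤r₂ (subst (r₂ ≤_) (sym (uni e e∈H)) r₂≤r₁)
... | f , f⊆e , ∣f∣ , v∈f = f , shadowGraph-∈ H f ∣f∣ (e , e∈H , f⊆e) , v∈f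

minPosDeg-shadowGraph : ∀ (H : Hypergraph n) → Partite H k →
  ∀ {i r₁ r₂} → i < r₂ → r₂ ≤ r₁ → r₁ ≤ k → ∀ q → 0ℚ ℚ.≤ q →
  MinPosDegGt H r₁ i (ℕ→ℚ ((k ∸ i) C (r₁ ∸ i)) ℚ.* (q ^ℚ (r₁ ∸ i))) →
  MinPosDegGt (shadowGraph r₂ H) r₂ i (ℕ→ℚ ((k ∸ i) C (r₂ ∸ i)) ℚ.* (q ^ℚ (r₂ ∸ i)))
minPosDeg-shadowGraph {n} {k} H (φ , col) {i} {r₁} {r₂} i<r₂ r₂≤r₁ r₁≤k q q≥0 δ⁺ S S∈ =
  let A , B , B≢0 , qB≡A = fraction q q≥0 in
  ℕ⇒threshold {q} {A} {B} {{B≢0}} qB≡A ((k ∸ i) C (r₂ ∸ i)) n (r₂ ∸ i) (deg (shadowGraph r₂ H) r₂ S)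
    -- The numerator is `A * n` because t = q n.
    (shadow-degree H φ col i<r₂ r₂≤r₁ r₁≤k (A * n) B B≢0 S S∈H
      (threshold⇒ℕ {q} {A} {B} {{B≢0}} qB≡A ((k ∸ i) C (r₁ ∸ i)) n (r₁ ∸ i) (deg H r₁ S) (δ⁺ S S∈H)))
  where S∈H = InShadow-shadowGraph H S S∈

-- The two roots are compared through rationals: any q ≥ 0 strictly above the root for r₂ is at
-- least the root for r₁. Raising to the powers r₂ - i and r₁ - i removes the roots.
theorem1p3 : (k r₁ r₂ i : ℕ) → 1 ≤ i → i < r₂ → r₂ ≤ r₁ → r₁ ≤ k →
    (q : ℚ) → 0ℚ ℚ.≤ q →
    ΦLt k r₂ i (ℕ→ℚ ((k ∸ i) C (r₂ ∸ i)) ℚ.* (q ^ℚ (r₂ ∸ i))) →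
    ΦLe k r₁ i (ℕ→ℚ ((k ∸ i) C (r₁ ∸ i)) ℚ.* (q ^ℚ (r₁ ∸ i)))
theorem1p3 k r₁ r₂ i 1≤i i<r₂ r₂≤r₁ r₁≤k q q≥0 (c , c<x , good) n k≤n H uni (φ , col) noIso δ⁺ =
  (φ , col) , λ ψ ϑ ψ-col ϑ-col →
    proj₂ unique ψ ϑ (shadowGraph-coloring H ψ ψ-col) (shadowGraph-coloring H ϑ ϑ-col)
  where
    unique : UniquelyColorable (shadowGraph r₂ H) k
    unique = good n k≤n (shadowGraph r₂ H)
      (λ e e∈ → proj₁ (∈-shadowGraph H e e∈))
      (φ , shadowGraph-coloring H φ col)
      (noIsolated-shadowGraph H (m<n⇒0<n i<r₂) r₂≤r₁ uni noIso)
      -- `good` holds at some c below the threshold for q, so the degree bound is weakened to c.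
      (minPosDeg-weaken (shadowGraph r₂ H) r₂ i (ℚ.<⇒≤ c<x)
        (minPosDeg-shadowGraph H (φ , col) i<r₂ r₂≤r₁ r₁≤k q q≥0 δ⁺))
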